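{- Up to scaling all sizes by a positive factor, rotating, and reversing the circular order, there is a unique cutting of the pizza into $21$ slices having at most two different slice sizes for which Bob has a strategy with gain $5|P|/9$; namely the cutting with sizes, in circular order, $$0,0,1,0,1,0,0,1,0,1,0,1,0,0,1,0,1,0,1,0,1.$$
   Context: The pizza game: a pizza is cut into $n\ge1$ slices forming a circular sequence $P=p_0p_1\dots p_{n-1}$ (indices modulo $n$, $p_i$ adjacent to $p_{i\pm1}$), each slice having a size $|p_i|\ge 0$; $|P|=\sum_i|p_i|$. Alice and Bob alternately take slices, one per turn, Alice first. In the first turn Alice may take any slice; in every later turn the player must take a slice that has a neighbor already taken. A strategy has gain $g$ if it guarantees the player a set of slices of total size at least $g$, whatever the opponent does.
   Formalization: The slice sizes are taken to be rational numbers rather than arbitrary nonnegative reals, and the all-zero pizza is excluded. -}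

module Defs where

open import Data.Nat as ℕ using (ℕ; zero; suc; _∸_)
open import Data.Nat.DivMod using (_%_; m%n<n)
open import Data.Fin as Fin using (Fin; toℕ; fromℕ<)
open import Data.Fin.Subset using (Subset; _∈_; _∉_; ⁅_⁆; _∪_; ∣_∣; ⊤; ⊥)
open import Data.Rational using (ℚ; 0ℚ; 1ℚ; _+_; _≤_)
open import Data.Vec using (Vec; []; _∷_; lookup)
open import Data.Product using (∃; _×_)
open import Data.Sum using (_⊎_)
open import Relation.Binary.PropositionalEquality using (_≡_; _≢_)

total : ∀ {n} → (Fin n → ℚ) → ℚ
total {zero}  p = 0ℚ
total {suc n} p = p Fin.zero + total (λ i → p (Fin.suc i))

next : ∀ {m} → Fin (suc m) → Fin (suc m)
next {m} i = fromℕ< (m%n<n (suc (toℕ i)) (suc m))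

prev : ∀ {m} → Fin (suc m) → Fin (suc m)
prev {m} i = fromℕ< (m%n<n (toℕ i ℕ.+ m) (suc m))

Legal : ∀ {m} → Subset (suc m) → Fin (suc m) → Set
Legal S i = (S ≡ ⊥) ⊎ (i ∉ S × (prev i ∈ S ⊎ next i ∈ S))

AliceTurn : ∀ {m} → Subset (suc m) → Set
AliceTurn S = ∣ S ∣ % 2 ≡ 0

BobTurn : ∀ {m} → Subset (suc m) → Set
BobTurn S = ∣ S ∣ % 2 ≡ 1

-- BobGuarantees p g S b : from the position where the slices in S are taken
-- and Bob has so far collected total size b, Bob has a strategy ensuring
-- that his final total is at least g, whatever Alice does.
data BobGuarantees {m} (p : Fin (suc m) → ℚ) (g : ℚ) : Subset (suc m) → ℚ → Set where
  done  : ∀ {S b} → S ≡ ⊤ → g ≤ b → BobGuarantees p g S b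
  alice : ∀ {S b} → S ≢ ⊤ → AliceTurn S →
          (∀ i → Legal S i → BobGuarantees p g (S ∪ ⁅ i ⁆) b) →
          BobGuarantees p g S b
  bob   : ∀ {S b} → BobTurn S → (i : Fin (suc m)) → Legal S i →
          BobGuarantees p g (S ∪ ⁅ i ⁆) (b + p i) →
          BobGuarantees p g S b

BobHasGain : ∀ {m} → (Fin (suc m) → ℚ) → ℚ → Set
BobHasGain p g = BobGuarantees p g ⊥ 0ℚ

rot : ∀ {m} → Fin (suc m) → Fin (suc m) → Fin (suc m)
rot {m} r i = fromℕ< (m%n<n (toℕ r ℕ.+ toℕ i) (suc m))

refl′ : ∀ {m} → Fin (suc m) → Fin (suc m) → Fin (suc m)
refl′ {m} r i = fromℕ< (m%n<n (toℕ r ℕ.+ (suc m ∸ toℕ i)) (suc m))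

specialVec : Vec ℚ 21
specialVec = 0ℚ ∷ 0ℚ ∷ 1ℚ ∷ 0ℚ ∷ 1ℚ ∷ 0ℚ ∷ 0ℚ ∷ 1ℚ ∷ 0ℚ ∷ 1ℚ ∷ 0ℚ ∷
             1ℚ ∷ 0ℚ ∷ 0ℚ ∷ 1ℚ ∷ 0ℚ ∷ 1ℚ ∷ 0ℚ ∷ 1ℚ ∷ 0ℚ ∷ 1ℚ ∷ []

special : Fin 21 → ℚ
special = lookup specialVec

-- Both players always take a fixed number of slices (Alice 11, Bob 10), so with
-- sizes lo + x i · d, x i ∈ {0, 1}, the game is decided by the 0/1 sizes x: if x
-- has k ones and Bob collects V of them, gain 5/9 means 15 lo + (5 k − 9 V) d ≤ 0.
-- Unless the pizza is worthless, this forces lo = 0 and 9 V ≥ 5 k, so it remains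
-- to find the circular 0/1 words on which Bob gets 9 V ≥ 5 k against every first
-- move of Alice.  After that move the untaken slices form an arc, and V is
-- computed by recursion on arcs.
--
-- The words are enumerated in the order y m = x (2 m), one lexicographically
-- minimal rotation each.  On most of them Alice wins by always taking the slice
-- next to the one Bob has just taken: Bob then gets a window of ten consecutive
-- terms of y, one of eleven consecutive windows fixed by her first move, so it
-- suffices that eleven consecutive windows have sum below 5 k / 9.  On the others
-- the recursion is evaluated.

module Submission where

open import Defs
open import Data.Bool using (Bool; true; false; not; _∧_; _∨_; if_then_else_; T)
open import Data.Fin using (Fin; toℕ; fromℕ<)
import Data.Fin.Properties as Fin
open import Data.List using (List; []; _∷_; length; take; drop; reverse; _++_)
open import Data.List.Relation.Unary.All as All using (All)
open import Data.List.Relation.Unary.Any using (Any; any?; here; there)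
open import Data.Product using (∃; ∃₂; _×_; _,_; proj₁; proj₂)
open import Data.Sum using (_⊎_; inj₁; inj₂; [_,_]′)
open import Function using (_∘_; Equivalence)
open import Relation.Binary.PropositionalEquality
open import Relation.Nullary using (Dec; does; yes; no; ¬?; _×-dec_; _⊎-dec_; _→-dec_; contradiction)
open import Relation.Nullary.Decidable using (isYes; map′; toWitness)

module Words where

  open import Data.Bool.Properties using (T-∨; T-≡; ∧-conicalˡ; ∧-conicalʳ)
  open import Data.List.Properties using (≡-dec)
  open import Data.Nat using (ℕ; zero; suc; z≤n; s≤s; _+_; _*_; _∸_; _⊔_; _⊓_; _⊔′_; _⊓′_; _≤_; _<_; _<ᵇ_; _≟_; _≤?_)
  open import Data.Nat.DivMod using (_%_; _/_; m≡m%n+[m/n]*n; m%n<n)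
  open import Data.Nat.ListAction using (sum)
  open import Data.Nat.Properties hiding (_≟_; _≤?_)
  open import Algebra.Properties.CommutativeSemigroup +-commutativeSemigroup using (x∙yz≈y∙xz)
  open import Data.Nat.Solver using (module +-*-Solver)
  open import Data.Unit using (tt)

  -- Windows of sequences, the 5/9 threshold and period 21.

  tab : (ℕ → ℕ) → ℕ → ℕ → List ℕ
  tab f u zero    = []
  tab f u (suc n) = f u ∷ tab f (suc u) n

  nth : List ℕ → ℕ → ℕ
  nth []       _       = 0
  nth (a ∷ as) zero    = a
  nth (a ∷ as) (suc i) = nth as i

  nth-tab : ∀ f u {n i} → i < n → nth (tab f u n) i ≡ f (i + u)
  nth-tab f u {suc n} {zero}  _         = refl
  nth-tab f u {suc n} {suc i} (s≤s i<n) =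
    trans (nth-tab f (suc u) i<n) (cong f (+-suc i u))

  tab-cong : ∀ {f g} u n → (∀ i → f i ≡ g i) → tab f u n ≡ tab g u n
  tab-cong u zero    f≗g = refl
  tab-cong u (suc n) f≗g = cong₂ _∷_ (f≗g u) (tab-cong (suc u) n f≗g)

  tab-shift : ∀ f c u n → tab (λ i → f (c + i)) u n ≡ tab f (c + u) n
  tab-shift f c u zero    = refl
  tab-shift f c u (suc n) =
    cong (f (c + u) ∷_) (trans (tab-shift f c (suc u) n) (cong (λ v → tab f v n) (+-suc c u)))

  seg : (ℕ → ℕ) → ℕ → ℕ → ℕ
  seg f u n = sum (tab f u n)

  seg-snoc : ∀ f u n → seg f u (suc n) ≡ seg f u n + f (u + n)
  seg-snoc f u zero    = trans (+-identityʳ (f u)) (cong f (sym (+-identityʳ u)))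
  seg-snoc f u (suc n) = begin
    f u + seg f (suc u) (suc n)             ≡⟨ cong (f u +_) (seg-snoc f (suc u) n) ⟩
    f u + (seg f (suc u) n + f (suc u + n)) ≡⟨ +-assoc (f u) _ _ ⟨
    seg f u (suc n) + f (suc (u + n))       ≡⟨ cong (λ v → seg f u (suc n) + f v) (+-suc u n) ⟨
    seg f u (suc n) + f (u + suc n)         ∎
    where open ≡-Reasoning

  light : ℕ → ℕ → Bool
  light k w = (9 * w) <ᵇ (5 * k)

  opaque
    Light : ℕ → ℕ → Set
    Light k w = 9 * w < 5 * k

    Light-≤ : ∀ {k v w} → v ≤ w → Light k w → Light k v
    Light-≤ v≤w = ≤-<-trans (*-monoʳ-≤ 9 v≤w)

    light-< : ∀ {k w} → Light k w → 9 * w < 5 * k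
    light-< l = l

    light-sound : ∀ k w → T (light k w) → Light k w
    light-sound k w = <ᵇ⇒< (9 * w) (5 * k)

  Periodic : (ℕ → ℕ) → Set
  Periodic x = ∀ i → x (21 + i) ≡ x i

  periodic* : ∀ {x} → Periodic x → ∀ c i → x (c * 21 + i) ≡ x i
  periodic* per zero    i = refl
  periodic* per (suc c) i = trans (per (c * 21 + i)) (periodic* per c i)

  periodic-% : ∀ {x} → Periodic x → ∀ i → x (i % 21) ≡ x i
  periodic-% {x} per i = sym (begin
    x i                        ≡⟨ cong x (m≡m%n+[m/n]*n i 21) ⟩
    x (i % 21 + i / 21 * 21)   ≡⟨ cong x (+-comm (i % 21) (i / 21 * 21)) ⟩
    x (i / 21 * 21 + i % 21)   ≡⟨ periodic* per (i / 21) (i % 21) ⟩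
    x (i % 21)                 ∎)
    where open ≡-Reasoning

  tab-periodic : ∀ {x} → Periodic x → ∀ u n → tab x (21 + u) n ≡ tab x u n
  tab-periodic {x} per u n = trans (sym (tab-shift x 21 u n)) (tab-cong u n per)

  -- The value of the game

  -- The recursion of best below branches exponentially; the lists compute best x j
  -- for a range of starting points from the row for j − 1.
  nextRow : List ℕ → List ℕ → List ℕ → List ℕ
  nextRow (l ∷ ls) (r ∷ rs) (a ∷ b ∷ c ∷ vs) =
    ((l + (b ⊓′ c)) ⊔′ (r + (a ⊓′ b))) ∷ nextRow ls rs (b ∷ c ∷ vs)
  nextRow _ _ _ = []

  -- The primed operations evaluate quickly on literals; the unprimed ones have the order lemmas
  -- used for `best`.
  nextRow-cell : ∀ l r a b c → (l + (b ⊓′ c)) ⊔′ (r + (a ⊓′ b)) ≡ (l + (b ⊓ c)) ⊔ (r + (a ⊓ b))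
  nextRow-cell l r a b c =
    trans (cong₂ (λ v w → (l + v) ⊔′ (r + w)) (sym (⊓≡⊓′ b c)) (sym (⊓≡⊓′ a b)))
          (sym (⊔≡⊔′ (l + (b ⊓ c)) (r + (a ⊓ b))))

  -- `rs` begins at the far end of the arc that starts at 0. Arcs grow by two slices per row, so
  -- this end moves by two; each row also loses two entries, which is why `values` starts from
  -- `j * 2 + n` zeros.
  rows : ℕ → List ℕ → List ℕ → List ℕ → List ℕ
  rows zero    ls rs vs = vs
  rows (suc j) ls rs vs = rows j ls (drop 2 rs) (nextRow ls rs vs)

  values : ℕ → ℕ → List ℕ → List ℕ
  values j n xs = rows j xs (drop 1 xs) (tab (λ _ → 0) 0 (j * 2 + n))

  opaque
    -- What Bob, who is to move, still collects of the sizes x when the 2 j slices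
    -- s, …, s + 2 j − 1 are left and both play optimally.
    best : (ℕ → ℕ) → ℕ → ℕ → ℕ
    best x zero    s = 0
    best x (suc j) s = (x s + (best x j (suc s) ⊓ best x j (suc (suc s))))
                   ⊔ (x (s + suc (j * 2)) + (best x j s ⊓ best x j (suc s)))

    best-cong : ∀ {x y} → (∀ i → x i ≡ y i) → ∀ j s → best x j s ≡ best y j s
    best-cong x≗y zero    s = refl
    best-cong x≗y (suc j) s = cong₂ _⊔_
      (cong₂ _+_ (x≗y s) (cong₂ _⊓_ (best-cong x≗y j (suc s)) (best-cong x≗y j (suc (suc s)))))
      (cong₂ _+_ (x≗y _) (cong₂ _⊓_ (best-cong x≗y j s) (best-cong x≗y j (suc s))))

    best-shift : ∀ x c j s → best (λ i → x (c + i)) j s ≡ best x j (c + s)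
    best-shift x c zero    s = refl
    best-shift x c (suc j) s
      rewrite best-shift x c j s | best-shift x c j (suc s) | best-shift x c j (suc (suc s))
            | +-suc c (suc s) | +-suc c s | +-assoc c s (suc (j * 2)) = refl

    best-zero : ∀ x s → best x 0 s ≡ 0
    best-zero x s = refl

    best-left : ∀ x j s → x s + (best x j (suc s) ⊓ best x j (suc (suc s))) ≤ best x (suc j) s
    best-left x j s = m≤m⊔n _ _

    best-right : ∀ x j s → x (s + suc (j * 2)) + (best x j s ⊓ best x j (suc s)) ≤ best x (suc j) s
    best-right x j s = m≤n⊔m (x s + (best x j (suc s) ⊓ best x j (suc (suc s)))) _

    best-sel : ∀ x j s → best x (suc j) s ≡ x s + (best x j (suc s) ⊓ best x j (suc (suc s)))
                     ⊎ best x (suc j) s ≡ x (s + suc (j * 2)) + (best x j s ⊓ best x j (suc s))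
    best-sel x j s = ⊔-sel _ _

    -- The minimum is at most the outcome of one particular reply. Here Alice takes the slice that
    -- Bob's move has just exposed, which leaves the other end of the arc unchanged.
    best-bound : ∀ x j s → best x (suc j) s ≤ x s + best x j (suc (suc s))
                       ⊎ best x (suc j) s ≤ x (s + suc (j * 2)) + best x j s
    best-bound x j s with best-sel x j s
    ... | inj₁ e = inj₁ (≤-trans (≤-reflexive e) (+-monoʳ-≤ (x s) (m⊓n≤n _ _)))
    ... | inj₂ e = inj₂ (≤-trans (≤-reflexive e) (+-monoʳ-≤ (x _) (m⊓n≤m _ _)))

    nextRow-tab : ∀ x j s {n a b} → n ≤ a → n ≤ b →
      nextRow (tab x s a) (tab x (s + suc (j * 2)) b) (tab (best x j) s (2 + n)) ≡ tab (best x (suc j)) s n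
    nextRow-tab x j s {zero} {zero} _ _ = refl
    nextRow-tab x j s {zero} {suc a} {zero} _ _ = refl
    nextRow-tab x j s {zero} {suc a} {suc b} _ _ = refl
    nextRow-tab x j s {suc n} {suc a} {suc b} (s≤s n≤a) (s≤s n≤b) = cong₂ _∷_
      (nextRow-cell (x s) (x (s + suc (j * 2))) (best x j s) (best x j (suc s)) (best x j (suc (suc s))))
      (nextRow-tab x j (suc s) n≤a n≤b)

    rows-tab : ∀ x j i {n a} → j * 2 + n ≤ a →
      rows j (tab x 0 a) (tab x (suc (i * 2)) (j * 2 + n)) (tab (best x i) 0 (j * 2 + n)) ≡ tab (best x (j + i)) 0 n
    rows-tab x zero    i _ = refl
    rows-tab x (suc j) i {n} {a} ≤a
      rewrite nextRow-tab x i 0 {b = 2 + (j * 2 + n)} (≤-trans (m≤n+m _ 2) ≤a) (m≤n+m (j * 2 + n) 2) =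
      trans (rows-tab x j (suc i) (≤-trans (m≤n+m _ 2) ≤a))
            (cong (λ v → tab (best x v) 0 n) (+-suc j i))

    values-tab : ∀ x j n {xs} → xs ≡ tab x 0 (suc (j * 2 + n)) → values j n xs ≡ tab (best x j) 0 n
    values-tab x j n refl = trans (rows-tab x j 0 (n≤1+n _)) (cong (λ i → tab (best x i) 0 n) (+-identityʳ j))

  anyLight : ℕ → List ℕ → Bool
  anyLight k []       = false
  anyLight k (v ∷ vs) = light k v ∨ anyLight k vs

  anyLight-sound : ∀ k f u n → T (anyLight k (tab f u n)) → ∃ λ s → Light k (f s)
  anyLight-sound k f u (suc n) t with Equivalence.to T-∨ t
  ... | inj₁ l = u , light-sound k (f u) l
  ... | inj₂ l = anyLight-sound k f (suc u) n l

  -- When Alice always answers next to Bob's last move, Bob ends up with ten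
  -- consecutive terms of the sequence y m = x (2 m).
  follow : ∀ x k → Periodic x → ∀ j i w → i + j ≡ 10 →
           (∀ t → t ≤ j → Light k (seg (λ m → x (m * 2)) (w + t) 10)) →
           Light k (best x j ((j + w + i) * 2) + seg (λ m → x (m * 2)) (j + w) i)
  follow x k per zero i w i≡ windows =
    subst (Light k) (cong₂ _+_ (sym (best-zero x ((w + i) * 2)))
                               (cong₂ (seg (λ m → x (m * 2))) (+-identityʳ w) (trans (sym i≡) (+-identityʳ i))))
          (windows 0 z≤n)
  follow x k per (suc j) i w i≡ windows = [ left , right ]′ (best-bound x j s)
    where
    y : ℕ → ℕ
    y m = x (m * 2)
    s : ℕ
    s = (suc j + w + i) * 2

    i≡′ : suc i + j ≡ 10
    i≡′ = trans (sym (+-suc i j)) i≡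

    swap : ∀ a b c → a + b + c ≡ b + (c + a)
    swap a b c = trans (cong (_+ c) (+-comm a b)) (trans (+-assoc b a c) (cong (b +_) (+-comm a c)))

    -- Both ends of the arc are terms of `y` adjacent to the window collected so far: the near end
    -- is the term just after it, and the far end, modulo 21, is the term just before it.
    far : s + suc (j * 2) ≡ 21 + (j + w) * 2
    far = begin
      s + suc (j * 2)                         ≡⟨ solve 3 (λ j w i →
          (con 1 :+ j :+ w :+ i) :* con 2 :+ (con 1 :+ j :* con 2)
            := con 1 :+ (con 1 :+ i :+ j) :* con 2 :+ (j :+ w) :* con 2) refl j w i ⟩
      suc ((suc i + j) * 2) + (j + w) * 2     ≡⟨ cong (λ v → suc (v * 2) + (j + w) * 2) i≡′ ⟩
      21 + (j + w) * 2                        ∎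
      where open ≡-Reasoning
            open +-*-Solver

    -- The near end extends the window to the right, so its lowest possible final start rises to
    -- `suc w`.
    left : best x (suc j) s ≤ x s + best x j (suc (suc s)) → Light k (best x (suc j) s + seg y (suc j + w) i)
    left ≤left = Light-≤ {k} (≤-trans (+-monoˡ-≤ (seg y (suc j + w) i) ≤left) (≤-reflexive eq))
      (follow x k per j (suc i) (suc w) i≡′
        (λ t t≤j → subst (λ v → Light k (seg y v 10)) (+-suc w t) (windows (suc t) (s≤s t≤j))))
      where
      open ≡-Reasoning
      eq : x s + best x j (suc (suc s)) + seg y (suc j + w) i
         ≡ best x j ((j + suc w + suc i) * 2) + seg y (j + suc w) (suc i)
      eq = begin
        x s + best x j (suc (suc s)) + seg y (suc j + w) i
          ≡⟨ swap (x s) (best x j (suc (suc s))) (seg y (suc j + w) i) ⟩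
        best x j (suc (suc s)) + (seg y (suc j + w) i + y (suc j + w + i))
          ≡⟨ cong (best x j (suc (suc s)) +_) (seg-snoc y (suc j + w) i) ⟨
        best x j ((suc (suc j + w + i)) * 2) + seg y (suc j + w) (suc i)
          ≡⟨ cong₂ (λ v u → best x j (v * 2) + seg y u (suc i))
               (trans (+-suc (j + suc w) i) (cong (λ v → suc (v + i)) (+-suc j w))) (+-suc j w) ⟨
        best x j ((j + suc w + suc i) * 2) + seg y (j + suc w) (suc i) ∎

    -- The far end extends the window to the left; the lowest possible final start stays `w`, and
    -- only the highest one is lost.
    right : best x (suc j) s ≤ x (s + suc (j * 2)) + best x j s → Light k (best x (suc j) s + seg y (suc j + w) i)
    right ≤right = Light-≤ {k} (≤-trans (+-monoˡ-≤ (seg y (suc j + w) i) ≤right) (≤-reflexive eq))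
      (follow x k per j (suc i) w i≡′ (λ t t≤j → windows t (m≤n⇒m≤1+n t≤j)))
      where
      open ≡-Reasoning
      eq : x (s + suc (j * 2)) + best x j s + seg y (suc j + w) i
         ≡ best x j ((j + w + suc i) * 2) + seg y (j + w) (suc i)
      eq = begin
        x (s + suc (j * 2)) + best x j s + seg y (suc j + w) i
          ≡⟨ cong (λ v → v + best x j s + seg y (suc j + w) i) (trans (cong x far) (per ((j + w) * 2))) ⟩
        y (j + w) + best x j s + seg y (suc j + w) i
          ≡⟨ cong (_+ seg y (suc j + w) i) (+-comm (y (j + w)) (best x j s)) ⟩
        best x j s + y (j + w) + seg y (suc j + w) i
          ≡⟨ +-assoc (best x j s) (y (j + w)) (seg y (suc j + w) i) ⟩
        best x j s + seg y (j + w) (suc i)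
          ≡⟨ cong (λ v → best x j (v * 2) + seg y (j + w) (suc i)) (+-suc (j + w) i) ⟨
        best x j ((j + w + suc i) * 2) + seg y (j + w) (suc i) ∎

  -- Ten moves of Bob, each to the left or to the right, can end in any of the eleven windows that
  -- start at `w`, ..., `w + 10`.
  follow-all : ∀ x k → Periodic x → ∀ w →
    (∀ t → t ≤ 10 → Light k (seg (λ m → x (m * 2)) (w + t) 10)) → Light k (best x 10 ((10 + w) * 2))
  follow-all x k per w windows =
    subst (Light k) (trans (+-identityʳ (best x 10 ((10 + w + 0) * 2))) (cong (λ v → best x 10 (v * 2)) (+-identityʳ (10 + w))))
          (follow x k per 10 0 w refl windows)

  -- run k c w ys zs looks for eleven consecutive light windows of length ten, of
  -- which c are still missing; the current window has sum w, starts at the head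
  -- of ys and ends just before the head of zs.
  run : ℕ → ℕ → ℕ → List ℕ → List ℕ → Bool
  run k zero    w _        _        = true
  run k (suc c) w (y ∷ ys) (z ∷ zs) =
    if light k w then run k c ((w + z) ∸ y) ys zs else run k 11 ((w + z) ∸ y) ys zs
  run k (suc c) w _        _        = false

  -- Truncated subtraction is exact here because `y p` is a summand of the window.
  slide : ∀ y p → (seg y p 10 + y (p + 10)) ∸ y p ≡ seg y (suc p) 10
  slide y p = begin
    (seg y p 10 + y (p + 10)) ∸ y p ≡⟨ cong (_∸ y p) (seg-snoc y p 10) ⟨
    (y p + seg y (suc p) 10) ∸ y p  ≡⟨ m+n∸m≡n (y p) _ ⟩
    seg y (suc p) 10                ∎
    where open ≡-Reasoning

  run-slide : ∀ k y c p {q} a b → q ≡ suc p →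
    T (run k c ((seg y p 10 + y (p + 10)) ∸ y p) (tab y (suc p) a) (tab y (suc p + 10) b)) →
    T (run k c (seg y q 10) (tab y q a) (tab y (q + 10) b))
  run-slide k y c p a b refl =
    subst (λ v → T (run k c v (tab y (suc p) a) (tab y (suc p + 10) b))) (slide y p)

  -- Invariant: the `d` windows starting at `u`, ..., `u + d - 1` are light and the scan stands at
  -- `u + d`. A window that is not light restarts the count just after it.
  run-sound : ∀ k y c d u a b → c + d ≡ 11 → (∀ t → t < d → Light k (seg y (u + t) 10)) →
    T (run k c (seg y (u + d) 10) (tab y (u + d) a) (tab y (u + d + 10) b)) →
    ∃ λ w → ∀ t → t ≤ 10 → Light k (seg y (w + t) 10)
  run-sound k y zero d u a b refl lights _ = u , λ t t≤10 → lights t (s≤s t≤10)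
  run-sound k y (suc c) d u (suc a) (suc b) c+d lights found
    with light k (seg y (u + d) 10) in eq
  ... | true  = run-sound k y c (suc d) u a b (trans (+-suc c d) c+d) lights′
                  (run-slide k y c (u + d) a b (+-suc u d) found)
    where
    lights′ : ∀ t → t < suc d → Light k (seg y (u + t) 10)
    lights′ t (s≤s t≤d) with m≤n⇒m<n∨m≡n t≤d
    ... | inj₁ t<d  = lights t t<d
    ... | inj₂ refl = light-sound k _ (subst T (sym eq) tt)
  ... | false = run-sound k y 11 0 (suc (u + d)) a b refl (λ _ ())
                  (run-slide k y 11 (u + d) a b (+-identityʳ (suc (u + d))) found)

  -- The search

  -- In the order 0, 2, 4, …, 20, 1, 3, …: the zero word, then rotations of the
  -- special cutting and of its mirror image.
  exceptions : List (List ℕ)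
  exceptions = (0 ∷ 0 ∷ 0 ∷ 0 ∷ 0 ∷ 0 ∷ 0 ∷ 0 ∷ 0 ∷ 0 ∷ 0 ∷ 0 ∷ 0 ∷ 0 ∷ 0 ∷ 0 ∷ 0 ∷ 0 ∷ 0 ∷ 0 ∷ 0 ∷ [])
    ∷ (0 ∷ 0 ∷ 0 ∷ 0 ∷ 0 ∷ 1 ∷ 1 ∷ 0 ∷ 0 ∷ 0 ∷ 0 ∷ 1 ∷ 1 ∷ 1 ∷ 1 ∷ 0 ∷ 0 ∷ 0 ∷ 1 ∷ 1 ∷ 1 ∷ [])
    ∷ (0 ∷ 0 ∷ 0 ∷ 0 ∷ 0 ∷ 1 ∷ 1 ∷ 1 ∷ 0 ∷ 0 ∷ 0 ∷ 1 ∷ 1 ∷ 1 ∷ 1 ∷ 0 ∷ 0 ∷ 0 ∷ 0 ∷ 1 ∷ 1 ∷ [])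
    ∷ (0 ∷ 0 ∷ 0 ∷ 0 ∷ 1 ∷ 1 ∷ 0 ∷ 0 ∷ 0 ∷ 0 ∷ 1 ∷ 1 ∷ 1 ∷ 1 ∷ 0 ∷ 0 ∷ 0 ∷ 1 ∷ 1 ∷ 1 ∷ 0 ∷ [])
    ∷ []

  exceptional? : ∀ l → Dec (Any (l ≡_) exceptions)
  exceptional? l = any? (≡-dec _≟_ l) exceptions

  -- Since 2 · 11 ≡ 1 (mod 21), undoes the passage from x to m ↦ x (2 m).  The
  -- length, always 42, is written so that nothing unfolds while l is a variable.
  halved : List ℕ → List ℕ
  halved l = tab (λ i → nth l ((11 * i) % 21)) 0 (length (l ++ l))

  -- Doubling the word lets a run of windows wrap around the circle. The exact values of all 21 arcs
  -- are the fallback when no run is found.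
  aliceWins : ℕ → List ℕ → Bool
  aliceWins k l = run k 11 (sum (take 10 l)) (l ++ l) (drop 10 l ++ l) ∨ anyLight k (values 10 21 (halved l))

  leaf : List ℕ → Bool
  leaf l = aliceWins (sum l) l ∨ isYes (exceptional? l)

  run-found : ∀ k y u a b {w ys zs} → w ≡ seg y u 10 → ys ≡ tab y u a → zs ≡ tab y (u + 10) b →
    T (run k 11 w ys zs) → ∃ λ v → ∀ t → t ≤ 10 → Light k (seg y (v + t) 10)
  run-found k y u a b refl refl refl found = run-sound k y 11 0 u a b refl (λ _ ())
    (subst (λ v → T (run k 11 (seg y v 10) (tab y v a) (tab y (v + 10) b))) (sym (+-identityʳ u)) found)

  halved-tab : ∀ {y l} → Periodic y → l ≡ tab y 0 21 → halved l ≡ tab (λ i → y (11 * i)) 0 42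
  halved-tab {y} {l} per l≡ = trans (cong halved l≡) (tab-cong 0 42 λ i →
    trans (nth-tab y 0 {21} (m%n<n (11 * i) 21))
          (trans (cong y (+-identityʳ _)) (periodic-% per (11 * i))))

  aliceWins-sound : ∀ k y l → Periodic y → l ≡ tab y 0 21 → T (aliceWins k l) →
                    ∃ λ s → Light k (best (λ i → y (11 * i)) 10 s)
  aliceWins-sound k y l per l≡ t = [ byRun , byValues ]′ (Equivalence.to T-∨ t)
    where
    x : ℕ → ℕ
    x i = y (11 * i)

    perx : Periodic x
    perx i = trans (cong y (*-distribˡ-+ 11 21 i)) (periodic* per 11 (11 * i))

    -- 11 · 2m = 21m + m.
    y≗ : ∀ m → y m ≡ x (m * 2)
    y≗ m = sym (trans (cong y (solve 1 (λ m → con 11 :* (m :* con 2) := m :* con 21 :+ m) refl m))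
                      (periodic* per m m))
      where open +-*-Solver

    appended : ∀ {l′} → l′ ≡ tab y 0 21 → l′ ≡ tab y 21 21
    appended l′≡ = trans l′≡ (sym (tab-periodic per 0 21))

    byRun : T (run k 11 (sum (take 10 l)) (l ++ l) (drop 10 l ++ l)) → ∃ λ s → Light k (best x 10 s)
    byRun r with run-found k y 0 42 32 (cong (sum ∘ take 10) l≡) (cong₂ _++_ l≡ (appended l≡))
                           (cong₂ _++_ (cong (drop 10) l≡) (appended l≡)) r
    ... | w , lights = (10 + w) * 2 , follow-all x k perx w λ t t≤10 →
            subst (Light k) (cong sum (tab-cong (w + t) 10 y≗)) (lights t t≤10)

    byValues : T (anyLight k (values 10 21 (halved l))) → ∃ λ s → Light k (best x 10 s)
    byValues v = anyLight-sound k (best x 10) 0 21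
      (subst (λ vs → T (anyLight k vs)) (values-tab x 10 21 (halved-tab {y} {l} per l≡)) v)

  -- Exceptional words only admit this weak inequality for some first move of Alice; it still forces
  -- `lo` to vanish.
  Fair : List ℕ → Set
  Fair l = Any (λ v → 9 * v ≤ 5 * sum l) (values 10 21 (halved l))

  exceptions-fair : All Fair exceptions
  exceptions-fair = toWitness {a? = All.all? (λ l → any? (λ v → (9 * v) ≤? (5 * sum l)) (values 10 21 (halved l))) exceptions} _

  Any-tab : ∀ (P : ℕ → Set) f u n → Any P (tab f u n) → ∃ λ s → P (f s)
  Any-tab P f u (suc n) (here px) = u , px
  Any-tab P f u (suc n) (there p) = Any-tab P f (suc u) n p

  fair-value : ∀ {y} l → Periodic y → l ≡ tab y 0 21 → Fair l →
    ∃ λ s → 9 * best (λ i → y (11 * i)) 10 s ≤ 5 * sum l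
  fair-value {y} l per l≡ fair = Any-tab (λ v → 9 * v ≤ 5 * sum l) (best (λ i → y (11 * i)) 10) 0 21
    (subst (Any (λ v → 9 * v ≤ 5 * sum l)) (values-tab (λ i → y (11 * i)) 10 21 (halved-tab {y} {l} per l≡)) fair)

  leaf-sound : ∀ y l → Periodic y → l ≡ tab y 0 21 → T (leaf l) →
    (∃ λ s → Light (sum l) (best (λ i → y (11 * i)) 10 s)) ⊎
    ((∃ λ s → 9 * best (λ i → y (11 * i)) 10 s ≤ 5 * sum l) × Any (l ≡_) exceptions)
  leaf-sound y l per l≡ t with Equivalence.to T-∨ t
  ... | inj₁ a = inj₁ (aliceWins-sound (sum l) y l per l≡ a)
  ... | inj₂ e = inj₂ (fair-value {y} l per l≡ (fair exceptions-fair l∈) , l∈)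
    where
    l∈ : Any (l ≡_) exceptions
    l∈ = toWitness {a? = exceptional? l} e
    fair : ∀ {es} → All Fair es → Any (l ≡_) es → Fair l
    fair (v All.∷ vs) (here refl) = v
    fair (v All.∷ vs) (there l∈)  = fair vs l∈

  -- search P f n q w tests P on all words that extend w (of length n, written
  -- backwards) by f letters and can be lexicographically minimal among their
  -- rotations.  The letters of w from position q + 1 on repeat a prefix of w, so
  -- the next letter must not be smaller than the one continuing that prefix.
  search : (List ℕ → Bool) → ℕ → ℕ → ℕ → List ℕ → Bool
  extend : (List ℕ → Bool) → ℕ → ℕ → ℕ → List ℕ → ℕ → Bool
  search P zero    n q w = P (reverse w)
  search P (suc f) n q w = extend P f n q w (nth w q)
  extend P f n q w zero    = search P f (suc n) q (0 ∷ w) ∧ search P f (suc n) n (1 ∷ w)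
  extend P f n q w (suc _) = search P f (suc n) q (1 ∷ w)

  opaque
    -- Words of equal length are compared lexicographically as binary numbers.
    val : (ℕ → ℕ) → ℕ → ℕ
    val f zero    = 0
    val f (suc n) = val f n + val f n + f n

    val-cong : ∀ {f g} n → (∀ {i} → i < n → f i ≡ g i) → val f n ≡ val g n
    val-cong zero    f≗g = refl
    val-cong {f} {g} (suc n) f≗g = cong₂ _+_ (cong₂ _+_ ih ih) (f≗g ≤-refl)
      where
      ih : val f n ≡ val g n
      ih = val-cong n (λ i<n → f≗g (m≤n⇒m≤1+n i<n))

    -- The first difference decides: a lead of one doubles with each further letter, which outweighs
    -- the at most one that the letter can take back.
    val-< : ∀ {f g} → (∀ i → f i ≤ 1) → ∀ i {n} → (∀ {j} → j < i → f j ≡ g j) → f i < g i →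
            i < n → val f n < val g n
    val-< {f} {g} f≤1 i {suc n} f≗g fi<gi (s≤s i≤n) with m≤n⇒m<n∨m≡n i≤n
    ... | inj₂ refl rewrite val-cong i f≗g = +-monoʳ-< (val g i + val g i) fi<gi
    ... | inj₁ i<n = begin-strict
      val f n + val f n + f n         ≤⟨ +-monoʳ-≤ (val f n + val f n) (f≤1 n) ⟩
      val f n + val f n + 1           <⟨ ≤-reflexive (solve 1 (λ v → con 1 :+ (v :+ v :+ con 1) := (con 1 :+ v) :+ (con 1 :+ v)) refl (val f n)) ⟩
      suc (val f n) + suc (val f n)   ≤⟨ +-mono-≤ ih ih ⟩
      val g n + val g n               ≤⟨ m≤m+n _ (g n) ⟩
      val g n + val g n + g n         ∎
      where
      open ≤-Reasoning
      open +-*-Solver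
      ih : val f n < val g n
      ih = val-< f≤1 i f≗g fi<gi i<n

  Minimal : (ℕ → ℕ) → Set
  Minimal y = ∀ t → val y 21 ≤ val (λ i → y (t + i)) 21

  backwards : (ℕ → ℕ) → ℕ → List ℕ
  backwards y zero    = []
  backwards y (suc n) = y n ∷ backwards y n

  nth-backwards : ∀ y q i → nth (backwards y (suc (q + i))) q ≡ y i
  nth-backwards y zero    i = refl
  nth-backwards y (suc q) i = nth-backwards y q i

  reverse-backwards : ∀ y → reverse (backwards y 21) ≡ tab y 0 21
  reverse-backwards y = refl

  -- Invariant: the last `i` of the `n` letters repeat the first `i`, starting at position `suc q`.
  -- As `w` is written backwards, its entry `q` is `y i`, the letter that the next one is compared
  -- with.
  search-sound : ∀ P {y} → (∀ i → y i ≤ 1) → Minimal y → ∀ f {n} q i {w} → w ≡ backwards y n →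
    n ≡ suc (q + i) → f + n ≡ 21 → (∀ {j} → j < i → y (suc q + j) ≡ y j) →
    search P f n q w ≡ true → ∃ λ l → l ≡ tab y 0 21 × T (P l)
  search-sound P {y} y≤1 min zero q i {w} w≡ _ refl rep t =
    reverse w , trans (cong reverse w≡) (reverse-backwards y) , Equivalence.from T-≡ t
  search-sound P {y} y≤1 min (suc f) {n} q i {w} w≡ n≡ f+n rep t = go (y i) (y n) refl refl (y≤1 i) (y≤1 n)
    where
    Goal : Set
    Goal = ∃ λ l → l ≡ tab y 0 21 × T (P l)

    f+n′ : f + suc n ≡ 21
    f+n′ = trans (+-suc f n) f+n

    nth≡ : nth w q ≡ y i
    nth≡ = trans (cong (λ v → nth v q) w≡)
          (trans (cong (λ m → nth (backwards y m) q) n≡) (nth-backwards y q i))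

    extended : ∀ {a} → y i ≡ a → extend P f n q w a ≡ true
    extended yi = subst (λ a → extend P f n q w a ≡ true) (trans nth≡ yi) t

    i<21 : i < 21
    i<21 = ≤-trans (s≤s (m≤n+m i q))
          (≤-trans (≤-reflexive (sym n≡)) (≤-trans (m≤n+m n (suc f)) (≤-reflexive f+n)))

    continue : ∀ {b} → y n ≡ b → y i ≡ b → search P f (suc n) q (b ∷ w) ≡ true → Goal
    continue yn yi = search-sound P y≤1 min f q (suc i) (cong₂ _∷_ (sym yn) w≡)
      (trans (cong suc n≡) (cong suc (sym (+-suc q i)))) f+n′ rep′
      where
      rep′ : ∀ {j} → j < suc i → y (suc q + j) ≡ y j
      rep′ (s≤s j≤i) with m≤n⇒m<n∨m≡n j≤i
      ... | inj₁ j<i  = rep j<i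
      ... | inj₂ refl = trans (cong y (sym n≡)) (trans yn (sym yi))

    go : ∀ a b → y i ≡ a → y n ≡ b → a ≤ 1 → b ≤ 1 → Goal
    go 0 0 yi yn _ _ = continue yn yi (∧-conicalˡ _ _ (extended yi))
    -- A larger letter ends the repetition; the new repeated prefix is empty and would start after
    -- this letter.
    go 0 1 yi yn _ _ = search-sound P y≤1 min f n 0 (cong₂ _∷_ (sym yn) w≡) (cong suc (sym (+-identityʳ n)))
      f+n′ (λ ()) (∧-conicalʳ _ _ (extended yi))
    go 1 1 yi yn _ _ = continue yn yi (extended yi)
    -- The rotation by `suc q` agrees with `y` for `i` letters and is then smaller, against
    -- minimality.
    go 1 0 yi yn _ _ = contradiction
      (val-< (λ j → y≤1 (suc q + j)) i rep
             (subst₂ _<_ (sym (trans (cong y (sym n≡)) yn)) (sym yi) (s≤s z≤n)) i<21)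
      (≤⇒≯ (min (suc q)))
    go (suc (suc _)) _ _ _ (s≤s ()) _
    go _ (suc (suc _)) _ _ _ (s≤s ())

  -- Lexicographically minimal rotations.

  opaque
    argmin : ∀ (v : ℕ → ℕ) n → ∃ λ m → ∀ {i} → i < suc n → v m ≤ v i
    argmin v zero    = 0 , λ { (s≤s z≤n) → ≤-refl }
    argmin v (suc n) with argmin v n
    ... | m , least with ≤-total (v m) (v (suc n))
    ...   | inj₁ vm≤ = m , λ { (s≤s i≤) → [ least , (λ { refl → vm≤ }) ]′ (m≤n⇒m<n∨m≡n i≤) }
    ...   | inj₂ ≤vm = suc n , λ { (s≤s i≤) → [ (λ i< → ≤-trans ≤vm (least i<)) , (λ { refl → ≤-refl }) ]′ (m≤n⇒m<n∨m≡n i≤) }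

  rotation-periodic : ∀ {y} → Periodic y → ∀ t → Periodic (λ i → y (t + i))
  rotation-periodic {y} per t i = trans (cong y {t + (21 + i)} {21 + (t + i)} (x∙yz≈y∙xz t 21 i)) (per (t + i))

  minimal-rotation : ∀ {y} → Periodic y → ∃ λ t → Minimal (λ i → y (t + i))
  minimal-rotation {y} per with argmin (λ t → val (λ i → y (t + i)) 21) 20
  ... | t , least = t , λ u → ≤-trans (least (m%n<n (t + u) 21)) (≤-reflexive
    (val-cong {λ i → y ((t + u) % 21 + i)} {λ i → y (t + (u + i))} 21 λ {i} _ → eq u i))
    where
    open ≡-Reasoning
    eq : ∀ u i → y ((t + u) % 21 + i) ≡ y (t + (u + i))
    eq u i = begin
      y ((t + u) % 21 + i)  ≡⟨ cong y (+-comm ((t + u) % 21) i) ⟩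
      y (i + (t + u) % 21)  ≡⟨ periodic-% {λ j → y (i + j)} (rotation-periodic {y} per i) (t + u) ⟩
      y (i + (t + u))       ≡⟨ cong y (trans (+-comm i (t + u)) (+-assoc t u i)) ⟩
      y (t + (u + i))       ∎

  -- Sums over a full period.

  seg-suc : ∀ {x} → Periodic x → ∀ u → seg x (suc u) 21 ≡ seg x u 21
  seg-suc {x} per u = begin
    seg x (suc u) 21            ≡⟨ seg-snoc x (suc u) 20 ⟩
    seg x (suc u) 20 + x (suc u + 20)
      ≡⟨ cong (seg x (suc u) 20 +_) (trans (cong x (cong suc (+-comm u 20))) (per u)) ⟩
    seg x (suc u) 20 + x u      ≡⟨ +-comm (seg x (suc u) 20) (x u) ⟩
    seg x u 21                  ∎
    where open ≡-Reasoning

  seg-rotate : ∀ {x} → Periodic x → ∀ u → seg x u 21 ≡ seg x 0 21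
  seg-rotate per zero    = refl
  seg-rotate per (suc u) = trans (seg-suc per u) (seg-rotate per u)

  seg-parity : ∀ x u n → seg x (u * 2) (n * 2) ≡ seg (λ m → x (m * 2)) u n + seg (λ m → x (suc (m * 2))) u n
  seg-parity x u zero    = refl
  seg-parity x u (suc n) = trans (cong (λ v → x (u * 2) + (x (suc (u * 2)) + v)) (seg-parity x (suc u) n))
    (solve 4 (λ a b c d → a :+ (b :+ (c :+ d)) := a :+ c :+ (b :+ d)) refl
       (x (u * 2)) (x (suc (u * 2))) (seg (λ m → x (m * 2)) (suc u) n) (seg (λ m → x (suc (m * 2))) (suc u) n))
    where open +-*-Solver

  seg-++ : ∀ x u m n → seg x u (m + n) ≡ seg x u m + seg x (u + m) n
  seg-++ x u zero    n = cong (λ v → seg x v n) (sym (+-identityʳ u))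
  seg-++ x u (suc m) n = trans (cong (x u +_) (trans (seg-++ x (suc u) m n) (cong (λ v → seg x (suc u) m + seg x v n) (sym (+-suc u m)))))
                               (sym (+-assoc (x u) (seg x (suc u) m) (seg x (u + suc m) n)))

  -- Doubling permutes the residues modulo 21: 0, 2, ..., 20 are the even ones, and 22, ..., 40
  -- reduce to the odd ones.
  seg-double : ∀ {x} → Periodic x → seg (λ m → x (m * 2)) 0 21 ≡ seg x 0 21
  seg-double {x} per = begin
    seg e 0 21                ≡⟨ seg-++ e 0 10 11 ⟩
    seg e 0 10 + seg e 10 11  ≡⟨ cong (seg e 0 10 +_) (+-comm (e 10) (seg e 11 10)) ⟩
    seg e 0 10 + (seg e 11 10 + e 10) ≡⟨ cong (λ v → seg e 0 10 + (v + e 10)) e≗o ⟩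
    seg e 0 10 + (seg o 0 10 + e 10)  ≡⟨ +-assoc (seg e 0 10) _ _ ⟨
    seg e 0 10 + seg o 0 10 + e 10    ≡⟨ cong (_+ e 10) (seg-parity x 0 10) ⟨
    seg x 0 20 + x 20         ≡⟨ seg-snoc x 0 20 ⟨
    seg x 0 21                ∎
    where
    open ≡-Reasoning
    e o : ℕ → ℕ
    e m = x (m * 2)
    o m = x (suc (m * 2))
    e≗o : seg e 11 10 ≡ seg o 0 10
    e≗o = trans (cong sum (sym (tab-shift e 11 0 10))) (cong sum (tab-cong 0 10 (λ m → per (suc (m * 2)))))

  -- Rotations in steps of two, and the classification of words.

  rotated : (ℕ → ℕ) → ℕ → ℕ → ℕ
  rotated x t m = x ((t + m) * 2)

  -- Since 22 i = 21 i + i, passing back with the factor 11 turns a rotation by `t` in steps of two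
  -- into one by `t * 2` on the circle.
  rotated-11 : ∀ {x} → Periodic x → ∀ t i → rotated x t (11 * i) ≡ x (t * 2 + i)
  rotated-11 {x} per t i = trans (cong x index) (periodic* per i (t * 2 + i))
    where
    open ≡-Reasoning
    index : (t + 11 * i) * 2 ≡ i * 21 + (t * 2 + i)
    index = begin
      (t + 11 * i) * 2        ≡⟨ *-distribʳ-+ 2 t (11 * i) ⟩
      t * 2 + 11 * i * 2      ≡⟨ cong (λ v → t * 2 + v * 2) (*-comm 11 i) ⟩
      t * 2 + i * 11 * 2      ≡⟨ cong (t * 2 +_) (trans (*-assoc i 11 2) (*-suc i 21)) ⟩
      t * 2 + (i + i * 21)    ≡⟨ +-assoc (t * 2) i (i * 21) ⟨
      t * 2 + i + i * 21      ≡⟨ +-comm (t * 2 + i) (i * 21) ⟩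
      i * 21 + (t * 2 + i)    ∎

  double-periodic : ∀ {x} → Periodic x → Periodic (λ m → x (m * 2))
  double-periodic per m = trans (per (21 + m * 2)) (per (m * 2))

  rotated-periodic : ∀ {x} → Periodic x → ∀ t → Periodic (rotated x t)
  rotated-periodic {x} per t = rotation-periodic {λ m → x (m * 2)} (double-periodic per) t

  seg-rotated : ∀ {x} → Periodic x → ∀ t → seg (rotated x t) 0 21 ≡ seg x 0 21
  seg-rotated {x} per t = trans (cong sum (tab-shift (λ m → x (m * 2)) t 0 21))
    (trans (seg-rotate {λ m → x (m * 2)} (double-periodic per) (t + 0)) (seg-double per))

  -- In the first case some first move of Alice keeps Bob strictly below 5/9 of the ones; in the
  -- second the word is one of the listed candidates.
  Classified : (ℕ → ℕ) → Set
  Classified x = (∃ λ s → Light (seg x 0 21) (best x 10 s)) ⊎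
    ((∃ λ s → 9 * best x 10 s ≤ 5 * seg x 0 21) × ∃ λ t → Any (tab (rotated x t) 0 21 ≡_) exceptions)

  -- With P in place of leaf, the search cannot be unfolded in this proof.
  module Classify
    (P : List ℕ → Bool)
    (P-sound : ∀ y l → Periodic y → l ≡ tab y 0 21 → T (P l) →
      (∃ λ s → Light (sum l) (best (λ i → y (11 * i)) 10 s)) ⊎
      ((∃ λ s → 9 * best (λ i → y (11 * i)) 10 s ≤ 5 * sum l) × Any (l ≡_) exceptions))
    (search₀ : search P 20 1 0 (0 ∷ []) ≡ true)
    (search₁ : search P 20 1 0 (1 ∷ []) ≡ true)
    where

    classify : ∀ {x} → (∀ i → x i ≤ 1) → Periodic x → Classified x
    classify {x} x≤1 per = conclude (found (y 0) refl (x≤1 _))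
      where
      pere : Periodic (λ m → x (m * 2))
      pere = double-periodic per

      t : ℕ
      t = proj₁ (minimal-rotation pere)

      y : ℕ → ℕ
      y = rotated x t

      pery : Periodic y
      pery = rotated-periodic per t

      min : Minimal y
      min = proj₂ (minimal-rotation pere)

      found : ∀ a → y 0 ≡ a → a ≤ 1 → ∃ λ l → l ≡ tab y 0 21 × T (P l)
      found 0 y0 _ = search-sound P (λ i → x≤1 _) min 20 {1} 0 0 {0 ∷ []} (cong (_∷ []) (sym y0)) refl refl (λ ()) search₀
      found 1 y0 _ = search-sound P (λ i → x≤1 _) min 20 {1} 0 0 {1 ∷ []} (cong (_∷ []) (sym y0)) refl refl (λ ()) search₁
      found (suc (suc _)) _ (s≤s ())

      value≡ : ∀ s → best (λ i → y (11 * i)) 10 s ≡ best x 10 (t * 2 + s)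
      value≡ s = trans (best-cong (rotated-11 per t) 10 s) (best-shift x (t * 2) 10 s)

      conclude : (∃ λ l → l ≡ tab y 0 21 × T (P l)) → Classified x
      conclude (l , l≡ , found) with P-sound y l pery l≡ found
      ... | inj₁ (s , light) = inj₁ (t * 2 + s , subst₂ Light (trans (cong sum l≡) (seg-rotated per t)) (value≡ s) light)
      ... | inj₂ ((s , ≤value) , l∈) = inj₂
              ( (t * 2 + s , subst₂ (λ v k → 9 * v ≤ 5 * k) (value≡ s) (trans (cong sum l≡) (seg-rotated per t)) ≤value)
              , t , subst (λ l → Any (l ≡_) exceptions) l≡ l∈)

open import Data.Integer using (+_)
import Data.Rational as ℚ
import Data.Rational.Properties as ℚ
open import Data.Rational using (ℚ; 0ℚ; 1ℚ)

module Game where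

  open Words
  open import Algebra.Bundles using (CommutativeMonoid)
  open import Algebra.Properties.CommutativeMonoid.Mult ℚ.+-0-commutativeMonoid using (×-distrib-+)
  open import Algebra.Properties.CommutativeSemigroup
    (CommutativeMonoid.commutativeSemigroup ℚ.+-0-commutativeMonoid) using (interchange)
  open import Algebra.Properties.Monoid.Mult ℚ.+-0-monoid using (×-homo-+; ×-assocˡ) renaming (_×_ to _·_)
  import Data.Bool.Properties as Bool
  open import Data.Fin.Subset using (Subset; _∈_; ⁅_⁆; _∪_; ∣_∣; ⊤; ⊥)
  open import Data.Fin.Subset.Properties using (_∈?_; ∈⊤)
  open import Data.Nat as ℕ using (ℕ; zero; suc; z≤n; s≤s; _+_; _*_; _∸_; _⊓_; _≤_; _<_; _<ᵇ_)
  open import Data.Nat.DivMod using (_%_; m%n<n; m%n%n≡m%n; %-distribˡ-+; m<n⇒m%n≡m; [m+n]%n≡m%n)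
  open import Data.Nat.ListAction using (sum)
  open import Data.Nat.Properties
  open import Data.Vec using (Vec; []; _∷_; lookup; tabulate)
  open import Data.Vec.Properties using (≡-dec)

  -- Slices indexed by natural numbers modulo 21.

  slice : ℕ → Fin 21
  slice s = fromℕ< (m%n<n s 21)

  toℕ-slice : ∀ s → toℕ (slice s) ≡ s % 21
  toℕ-slice s = Fin.toℕ-fromℕ< (m%n<n s 21)

  slice-cong : ∀ a b → a % 21 ≡ b % 21 → slice a ≡ slice b
  slice-cong a b eq = Fin.toℕ-injective (trans (toℕ-slice a) (trans eq (sym (toℕ-slice b))))

  slice-+ : ∀ s t → slice (toℕ (slice s) + t) ≡ slice (s + t)
  slice-+ s t = slice-cong (toℕ (slice s) + t) (s + t) (begin
    (toℕ (slice s) + t) % 21        ≡⟨ cong (λ v → (v + t) % 21) (toℕ-slice s) ⟩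
    (s % 21 + t) % 21               ≡⟨ %-distribˡ-+ (s % 21) t 21 ⟩
    (s % 21 % 21 + t % 21) % 21     ≡⟨ cong (λ v → (v + t % 21) % 21) (m%n%n≡m%n s 21) ⟩
    (s % 21 + t % 21) % 21          ≡⟨ %-distribˡ-+ s t 21 ⟨
    (s + t) % 21                    ∎)
    where open ≡-Reasoning

  slice-suc : ∀ s → next (slice s) ≡ slice (suc s)
  slice-suc s = trans (cong slice (+-comm 1 (toℕ (slice s)))) (trans (slice-+ s 1) (cong slice (+-comm s 1)))

  slice-toℕ : ∀ i → slice (toℕ i) ≡ i
  slice-toℕ i = Fin.toℕ-injective (trans (toℕ-slice (toℕ i)) (m<n⇒m%n≡m (Fin.toℕ<n i)))

  far : Fin 21 → ℕ → Fin 21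
  far s t = slice (toℕ s + t)

  -- Positions of the game as arcs.

  _≟ˢ_ : ∀ (S S′ : Subset 21) → Dec (S ≡ S′)
  _≟ˢ_ = ≡-dec Bool._≟_

  legal? : ∀ (S : Subset 21) i → Dec (Legal S i)
  legal? S i = (S ≟ˢ ⊥) ⊎-dec (¬? (i ∈? S) ×-dec ((prev i ∈? S) ⊎-dec (next i ∈? S)))

  ends? : ∀ S a b → Dec (∀ i → Legal S i → i ≡ a ⊎ i ≡ b)
  ends? S a b = Fin.all? λ i → legal? S i →-dec ((i Fin.≟ a) ⊎-dec (i Fin.≟ b))

  reaches? : ∀ (S S′ : Subset 21) i → Dec (Legal S i × S ∪ ⁅ i ⁆ ≡ S′)
  reaches? S S′ i = legal? S i ×-dec ((S ∪ ⁅ i ⁆) ≟ˢ S′)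

  -- The moves from a position S with t slices left: a leads to Sₙ, b to Sₖ.
  record Position (t : ℕ) (S Sₙ Sₖ : Subset 21) (a b : Fin 21) : Set where
    field
      ends    : ∀ i → Legal S i → i ≡ a ⊎ i ≡ b
      near    : Legal S a × S ∪ ⁅ a ⁆ ≡ Sₙ
      further : Legal S b × S ∪ ⁅ b ⁆ ≡ Sₖ
      size    : ∣ S ∣ % 2 ≡ (21 ∸ t) % 2
      open′   : S ≢ ⊤

  position? : ∀ t S Sₙ Sₖ a b → Dec (Position t S Sₙ Sₖ a b)
  position? t S Sₙ Sₖ a b = map′ to from
    (ends? S a b ×-dec reaches? S Sₙ a ×-dec reaches? S Sₖ b ×-dec (∣ S ∣ % 2 ℕ.≟ (21 ∸ t) % 2) ×-dec ¬? (S ≟ˢ ⊤))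
    where
    to : _ → Position t S Sₙ Sₖ a b
    to (e , n , f , s , o) = record { ends = e ; near = n ; further = f ; size = s ; open′ = o }
    from : Position t S Sₙ Sₖ a b → _
    from p = let open Position p in ends , near , further , size , open′

  opaque
    -- The t consecutive slices from s on are left, all others are taken.
    taken : Fin 21 → ℕ → Subset 21
    taken s t = tabulate λ i → not (((toℕ i + (21 ∸ toℕ s)) % 21) <ᵇ t)

    -- Decided by evaluating all 21 · 20 arcs. Lengths run from 1 to 20: on the untouched pizza
    -- every slice is legal, not just two ends.
    positions : ∀ (s : Fin 21) (t : Fin 20) →
      Position (suc (toℕ t)) (taken s (suc (toℕ t))) (taken (next s) (toℕ t)) (taken s (toℕ t)) s (far s (toℕ t))
    positions = toWitness {a? = Fin.all? λ s → Fin.all? λ t → position? (suc (toℕ t)) _ _ _ _ _} _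

    taken-0 : ∀ s → taken s 0 ≡ ⊤
    taken-0 = toWitness {a? = Fin.all? λ s → taken s 0 ≟ˢ ⊤} _

    first-move : ∀ i → ⊥ ∪ ⁅ i ⁆ ≡ taken (next i) 20
    first-move = toWitness {a? = Fin.all? λ i → (⊥ ∪ ⁅ i ⁆) ≟ˢ taken (next i) 20} _

  position : ∀ s {t} → t < 20 →
    Position (suc t) (taken (slice s) (suc t)) (taken (slice (suc s)) t) (taken (slice s) t) (slice s) (slice (s + t))
  position s {t} t<20 = subst₂ (λ n f → Position (suc t) (taken (slice s) (suc t)) (taken n t) (taken (slice s) t) (slice s) f)
    (slice-suc s) (slice-+ s t)
    (subst (λ t → Position (suc t) (taken (slice s) (suc t)) (taken (next (slice s)) t) (taken (slice s) t) (slice s) (far (slice s) t))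
      (Fin.toℕ-fromℕ< t<20) (positions (slice s) (fromℕ< t<20)))

  -- Strategies compared with the recursion on arcs.

  parity-odd : ∀ j → j ≤ 10 → (21 ∸ j * 2) % 2 ≡ 1
  parity-odd j j≤10 = subst (λ j → (21 ∸ j * 2) % 2 ≡ 1) (Fin.toℕ-fromℕ< (s≤s j≤10))
    (toWitness {a? = Fin.all? {11} λ j → ((21 ∸ toℕ j * 2) % 2) ℕ.≟ 1} _ (fromℕ< (s≤s j≤10)))

  parity-even : ∀ j → j < 10 → (20 ∸ j * 2) % 2 ≡ 0
  parity-even j j<10 = subst (λ j → (20 ∸ j * 2) % 2 ≡ 0) (Fin.toℕ-fromℕ< j<10)
    (toWitness {a? = Fin.all? {10} λ j → ((20 ∸ toℕ j * 2) % 2) ℕ.≟ 0} _ (fromℕ< j<10))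

  -- The size of slice s is lo + x s · d, with x s ∈ {0, 1} in the application.
  module Play (p : Fin 21 → ℚ) (g lo d : ℚ) (x : ℕ → ℕ) (p≡ : ∀ s → p (slice s) ≡ lo ℚ.+ x s · d) where

    -- Bob's total when he has c slices and the sum of their x is B.
    score : ℕ → ℕ → ℚ
    score c B = c · lo ℚ.+ B · d

    score-take : ∀ c B s → score c B ℚ.+ p (slice s) ≡ score (suc c) (x s + B)
    score-take c B s = begin
      score c B ℚ.+ p (slice s)                         ≡⟨ cong (score c B ℚ.+_) (p≡ s) ⟩
      score c B ℚ.+ (lo ℚ.+ x s · d)                    ≡⟨ ℚ.+-comm (score c B) (lo ℚ.+ x s · d) ⟩
      (lo ℚ.+ x s · d) ℚ.+ (c · lo ℚ.+ B · d)           ≡⟨ ℚ.+-assoc lo (x s · d) (c · lo ℚ.+ B · d) ⟩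
      lo ℚ.+ (x s · d ℚ.+ (c · lo ℚ.+ B · d))           ≡⟨ cong (lo ℚ.+_) (ℚ.+-assoc (x s · d) (c · lo) (B · d)) ⟨
      lo ℚ.+ ((x s · d ℚ.+ c · lo) ℚ.+ B · d)           ≡⟨ cong (λ v → lo ℚ.+ (v ℚ.+ B · d)) (ℚ.+-comm (x s · d) (c · lo)) ⟩
      lo ℚ.+ ((c · lo ℚ.+ x s · d) ℚ.+ B · d)           ≡⟨ cong (lo ℚ.+_) (ℚ.+-assoc (c · lo) (x s · d) (B · d)) ⟩
      lo ℚ.+ (c · lo ℚ.+ (x s · d ℚ.+ B · d))           ≡⟨ ℚ.+-assoc lo (c · lo) (x s · d ℚ.+ B · d) ⟨
      suc c · lo ℚ.+ (x s · d ℚ.+ B · d)                ≡⟨ cong (suc c · lo ℚ.+_) (×-homo-+ d (x s) B) ⟨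
      score (suc c) (x s + B)                           ∎
      where open ≡-Reasoning

    Wins : ℕ → Set
    Wins B = g ℚ.≤ score 10 B

    module _ (mono : ∀ {B C} → B ≤ C → Wins B → Wins C) where

      wins-⊓ : ∀ a {m n} → Wins (a + m) → Wins (a + n) → Wins (a + (m ⊓ n))
      wins-⊓ a {m} {n} wm wn with ⊓-sel m n
      ... | inj₁ e = subst (λ v → Wins (a + v)) (sym e) wm
      ... | inj₂ e = subst (λ v → Wins (a + v)) (sym e) wn

      before-bob : ∀ B y {m v} → v ≡ y + m → Wins (B + v) → Wins ((y + B) + m)
      before-bob B y {m} refl = subst Wins (trans (sym (+-assoc B y m)) (cong (_+ m) (+-comm B y)))

      wins-after-bob : ∀ B y m {v} → y + m ≤ v → Wins ((y + B) + m) → Wins (B + v)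
      wins-after-bob B y m ≤v = mono (≤-trans (≤-reflexive (trans (cong (_+ m) (+-comm y B)) (+-assoc B y m))) (+-monoʳ-≤ B ≤v))

      -- Reads a strategy of Bob from the leaves up: his chosen move bounds the maximum in `best`
      -- from below, and since the strategy answers both replies of Alice, the bound holds for their
      -- minimum. `S` and `b` are tied by equations so that the strategy can be matched on.
      value-necessary : ∀ j {c} s B {S b} → c + j ≡ 10 → S ≡ taken (slice s) (j * 2) → b ≡ score c B →
        BobGuarantees p g S b → Wins (B + best x j s)
      reply-necessary : ∀ j {c} s B {S b} → c + j ≡ 10 → j < 10 → S ≡ taken (slice s) (suc (j * 2)) → b ≡ score c B →
        BobGuarantees p g S b → Wins (B + (best x j s ⊓ best x j (suc s)))

      value-necessary zero {c} s B c+0 S≡ b≡ (done _ g≤b) =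
        subst₂ (λ c v → g ℚ.≤ score c (B + v)) (trans (sym (+-identityʳ c)) c+0) (sym (best-zero x s))
          (subst (λ v → g ℚ.≤ score c v) (sym (+-identityʳ B)) (subst (g ℚ.≤_) b≡ g≤b))
      value-necessary zero s B c+0 S≡ b≡ (alice S≢⊤ _ _) = contradiction (trans S≡ (taken-0 (slice s))) S≢⊤
      -- With `j` zero every slice is taken, so no move is legal.
      value-necessary zero s B c+0 S≡ b≡ (bob turn i (inj₁ S≡⊥) _) =
        contradiction (trans (sym S≡⊥) (trans S≡ (taken-0 (slice s)))) λ ()
      value-necessary zero s B c+0 S≡ b≡ (bob turn i (inj₂ (i∉S , _)) _) =
        contradiction (subst (i ∈_) (sym (trans S≡ (taken-0 (slice s)))) ∈⊤) i∉S
      value-necessary (suc j) {c} s B c+j refl b≡ bg = bob-moves bg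
        where
        j<10 : j < 10
        j<10 = subst (suc j ≤_) c+j (m≤n+m (suc j) c)
        pos = position s {suc (j * 2)} (*-monoˡ-≤ 2 j<10)
        module P = Position pos
        c′ : suc c + j ≡ 10
        c′ = trans (sym (+-suc c j)) c+j
        bob-moves : BobGuarantees p g (taken (slice s) (suc j * 2)) _ → Wins (B + best x (suc j) s)
        bob-moves (done full _) = contradiction full P.open′
        bob-moves (alice _ even _) = contradiction (trans (sym even) (trans P.size (parity-odd (suc j) j<10))) λ ()
        bob-moves (bob _ i legal bg) with P.ends i legal
        ... | inj₁ refl = wins-after-bob B (x s) _ (best-left x j s)
                (reply-necessary j (suc s) (x s + B) c′ j<10 (proj₂ P.near)
                  (trans (cong (ℚ._+ p (slice s)) b≡) (score-take c B s)) bg)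
        ... | inj₂ refl = wins-after-bob B (x (s + suc (j * 2))) _ (best-right x j s)
                (reply-necessary j s (x (s + suc (j * 2)) + B) c′ j<10 (proj₂ P.further)
                  (trans (cong (ℚ._+ p (slice (s + suc (j * 2)))) b≡) (score-take c B (s + suc (j * 2)))) bg)

      reply-necessary j {c} s B c+j j<10 refl b≡ bg = alice-moves bg
        where
        pos = position s {j * 2} (≤-trans (n≤1+n _) (*-monoˡ-≤ 2 j<10))
        module P = Position pos
        alice-moves : BobGuarantees p g (taken (slice s) (suc (j * 2))) _ → Wins (B + (best x j s ⊓ best x j (suc s)))
        alice-moves (done full _) = contradiction full P.open′
        alice-moves (bob odd _ _ _) = contradiction (trans (sym odd) (trans P.size (parity-even j j<10))) λ ()
        alice-moves (alice _ _ bg) = wins-⊓ B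
          (value-necessary j s B c+j (proj₂ P.further) b≡ (bg _ (proj₁ P.further)))
          (value-necessary j (suc s) B c+j (proj₂ P.near) b≡ (bg _ (proj₁ P.near)))

      -- Bob takes an end that attains the maximum in `best`; whatever Alice replies, at least the
      -- minimum is left to him.
      value-sufficient : ∀ j {c} s B {S b} → c + j ≡ 10 → S ≡ taken (slice s) (j * 2) → b ≡ score c B →
        Wins (B + best x j s) → BobGuarantees p g S b
      reply-sufficient : ∀ j {c} s B {S b} → c + j ≡ 10 → j < 10 → S ≡ taken (slice s) (suc (j * 2)) → b ≡ score c B →
        Wins (B + (best x j s ⊓ best x j (suc s))) → BobGuarantees p g S b

      value-sufficient zero {c} s B c+0 S≡ b≡ win = done (trans S≡ (taken-0 (slice s)))
        (subst (g ℚ.≤_) (sym b≡) (subst (λ v → g ℚ.≤ score c v) (+-identityʳ B)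
          (subst₂ (λ c v → g ℚ.≤ score c (B + v)) (trans (sym c+0) (+-identityʳ c)) (best-zero x s) win)))
      value-sufficient (suc j) {c} s B c+j refl b≡ win with best-sel x j s
      ... | inj₁ e = bob (trans P.size (parity-odd (suc j) j<10)) (slice s) (proj₁ P.near)
              (reply-sufficient j (suc s) (x s + B) c′ j<10 (proj₂ P.near)
                (trans (cong (ℚ._+ p (slice s)) b≡) (score-take c B s)) (before-bob B (x s) e win))
        where
        j<10 : j < 10
        j<10 = subst (suc j ≤_) c+j (m≤n+m (suc j) c)
        c′ : suc c + j ≡ 10
        c′ = trans (sym (+-suc c j)) c+j
        module P = Position (position s {suc (j * 2)} (*-monoˡ-≤ 2 j<10))
      ... | inj₂ e = bob (trans P.size (parity-odd (suc j) j<10)) (slice (s + suc (j * 2))) (proj₁ P.further)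
              (reply-sufficient j s (x (s + suc (j * 2)) + B) c′ j<10 (proj₂ P.further)
                (trans (cong (ℚ._+ p (slice (s + suc (j * 2)))) b≡) (score-take c B (s + suc (j * 2))))
                (before-bob B (x (s + suc (j * 2))) e win))
        where
        j<10 : j < 10
        j<10 = subst (suc j ≤_) c+j (m≤n+m (suc j) c)
        c′ : suc c + j ≡ 10
        c′ = trans (sym (+-suc c j)) c+j
        module P = Position (position s {suc (j * 2)} (*-monoˡ-≤ 2 j<10))

      reply-sufficient j s B c+j j<10 refl b≡ win =
        alice P.open′ (trans P.size (parity-even j j<10)) reply
        where
        module P = Position (position s {j * 2} (≤-trans (n≤1+n _) (*-monoˡ-≤ 2 j<10)))
        reply : ∀ i → Legal (taken (slice s) (suc (j * 2))) i → BobGuarantees p g (taken (slice s) (suc (j * 2)) ∪ ⁅ i ⁆) _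
        reply i legal with P.ends i legal
        ... | inj₁ refl = value-sufficient j (suc s) B c+j (proj₂ P.near) b≡
                (mono (+-monoʳ-≤ B (m⊓n≤n (best x j s) (best x j (suc s)))) win)
        ... | inj₂ refl = value-sufficient j s B c+j (proj₂ P.further) b≡
                (mono (+-monoʳ-≤ B (m⊓n≤m (best x j s) (best x j (suc s)))) win)

      score-0 : 0ℚ ≡ score 0 0
      score-0 = refl

      gain-necessary : BobHasGain p g → ∀ s → Wins (best x 10 (suc s))
      gain-necessary (done full _) s = contradiction full λ ()
      gain-necessary (alice _ _ bg) s = value-necessary 10 {0} (suc s) 0 refl
        (trans (first-move (slice s)) (cong (λ i → taken i 20) (slice-suc s))) score-0 (bg (slice s) (inj₁ refl))

      gain-sufficient : (∀ s → Wins (best x 10 s)) → BobHasGain p g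
      gain-sufficient wins = alice (λ ()) refl λ i _ →
        value-sufficient 10 {0} (suc (toℕ i)) 0 refl (first-move i) score-0 (wins (suc (toℕ i)))

  -- Comparing 5/9 of the total with Bob's score

  ·-monoʳ-≤ : ∀ n {p q} → p ℚ.≤ q → n · p ℚ.≤ n · q
  ·-monoʳ-≤ zero    p≤q = ℚ.≤-refl
  ·-monoʳ-≤ (suc n) p≤q = ℚ.+-mono-≤ p≤q (·-monoʳ-≤ n p≤q)

  ·-zeroʳ : ∀ n → n · 0ℚ ≡ 0ℚ
  ·-zeroʳ zero    = refl
  ·-zeroʳ (suc n) = trans (ℚ.+-identityˡ (n · 0ℚ)) (·-zeroʳ n)

  ·-nonNeg : ∀ n {p} → 0ℚ ℚ.≤ p → 0ℚ ℚ.≤ n · p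
  ·-nonNeg n {p} 0≤p = subst (ℚ._≤ n · p) (·-zeroʳ n) (·-monoʳ-≤ n 0≤p)

  p≤p+q : ∀ p {q} → 0ℚ ℚ.≤ q → p ℚ.≤ p ℚ.+ q
  p≤p+q p {q} 0≤q = subst (ℚ._≤ p ℚ.+ q) (ℚ.+-identityʳ p) (ℚ.+-monoʳ-≤ p 0≤q)

  ·-monoˡ-≤ : ∀ {p} → 0ℚ ℚ.≤ p → ∀ {m n} → m ≤ n → m · p ℚ.≤ n · p
  ·-monoˡ-≤ {p} 0≤p {n = n} z≤n = ·-nonNeg n 0≤p
  ·-monoˡ-≤ {p} 0≤p (s≤s m≤n)   = ℚ.+-monoʳ-≤ p (·-monoˡ-≤ 0≤p m≤n)

  ·-cancelˡ-≤ : ∀ n {p q} → suc n · p ℚ.≤ suc n · q → p ℚ.≤ q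
  ·-cancelˡ-≤ n np≤nq = ℚ.≮⇒≥ λ q<p →
    ℚ.<-irrefl refl (ℚ.<-≤-trans (ℚ.+-mono-<-≤ q<p (·-monoʳ-≤ n (ℚ.<⇒≤ q<p))) np≤nq)

  ·-as-* : ∀ n p → n · p ≡ (n · 1ℚ) ℚ.* p
  ·-as-* zero    p = sym (ℚ.*-zeroˡ p)
  ·-as-* (suc n) p = trans (cong₂ ℚ._+_ (sym (ℚ.*-identityˡ p)) (·-as-* n p)) (sym (ℚ.*-distribʳ-+ p 1ℚ (n · 1ℚ)))

  nine-gains : ∀ T → 9 · ((+ 5 ℚ./ 9) ℚ.* T) ≡ 5 · T
  nine-gains T = begin
    9 · ((+ 5 ℚ./ 9) ℚ.* T)             ≡⟨ ·-as-* 9 ((+ 5 ℚ./ 9) ℚ.* T) ⟩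
    (9 · 1ℚ) ℚ.* ((+ 5 ℚ./ 9) ℚ.* T)    ≡⟨ ℚ.*-assoc (9 · 1ℚ) (+ 5 ℚ./ 9) T ⟨
    -- The coefficient `(9 · 1ℚ) ℚ.* (+ 5 ℚ./ 9)` evaluates to `5 · 1ℚ`.
    (5 · 1ℚ) ℚ.* T                      ≡⟨ ·-as-* 5 T ⟨
    5 · T                               ∎
    where open ≡-Reasoning

  ·-combination : ∀ n a b p q → n · (a · p ℚ.+ b · q) ≡ (n * a) · p ℚ.+ (n * b) · q
  ·-combination n a b p q = trans (×-distrib-+ (a · p) (b · q) n) (cong₂ ℚ._+_ (×-assocˡ p n a) (×-assocˡ q n b))

  +-cancelʳ-≤0 : ∀ p q → p ℚ.+ q ℚ.≤ q → p ℚ.≤ 0ℚ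
  +-cancelʳ-≤0 p q p+q≤q = subst₂ ℚ._≤_
    (trans (ℚ.+-assoc p q (ℚ.- q)) (trans (cong (p ℚ.+_) (ℚ.+-inverseʳ q)) (ℚ.+-identityʳ p)))
    (ℚ.+-inverseʳ q) (ℚ.+-monoˡ-≤ (ℚ.- q) p+q≤q)

  module _ {lo d : ℚ} (0≤lo : 0ℚ ℚ.≤ lo) (0≤d : 0ℚ ℚ.≤ d) where

    -- Nine times the gain reads 105 lo + 5 k d ≤ 90 lo + 9 V d. The slack `e` is 1 if Bob stays
    -- strictly below 5/9 of the ones and 0 if only the weak bound is known.
    gain-deficit : ∀ {k V e T} → T ≡ 21 · lo ℚ.+ k · d → 9 * V + e ≤ 5 * k →
      (+ 5 ℚ./ 9) ℚ.* T ℚ.≤ 10 · lo ℚ.+ V · d → 15 · lo ℚ.+ e · d ℚ.≤ 0ℚ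
    gain-deficit {k} {V} {e} {T} T≡ deficit gain = +-cancelʳ-≤0 _ (90 · lo ℚ.+ (9 * V) · d) (begin
      (15 · lo ℚ.+ e · d) ℚ.+ (90 · lo ℚ.+ (9 * V) · d) ≡⟨ interchange (15 · lo) (e · d) (90 · lo) ((9 * V) · d) ⟩
      (15 · lo ℚ.+ 90 · lo) ℚ.+ (e · d ℚ.+ (9 * V) · d) ≡⟨ cong₂ ℚ._+_ (×-homo-+ lo 15 90) (×-homo-+ d e (9 * V)) ⟨
      105 · lo ℚ.+ (e + 9 * V) · d                      ≤⟨ ℚ.+-monoʳ-≤ (105 · lo) (·-monoˡ-≤ 0≤d (≤-trans (≤-reflexive (+-comm e (9 * V))) deficit)) ⟩
      105 · lo ℚ.+ (5 * k) · d                          ≡⟨ ·-combination 5 21 k lo d ⟨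
      5 · (21 · lo ℚ.+ k · d)                           ≡⟨ cong (5 ·_) T≡ ⟨
      5 · T                                             ≡⟨ nine-gains T ⟨
      9 · ((+ 5 ℚ./ 9) ℚ.* T)                           ≤⟨ ·-monoʳ-≤ 9 gain ⟩
      9 · (10 · lo ℚ.+ V · d)                           ≡⟨ ·-combination 9 10 V lo d ⟩
      90 · lo ℚ.+ (9 * V) · d                           ∎)
      where open ℚ.≤-Reasoning

    lo-vanishes : ∀ {e} → 15 · lo ℚ.+ e · d ℚ.≤ 0ℚ → lo ≡ 0ℚ
    lo-vanishes {e} ≤0 = ℚ.≤-antisym
      (ℚ.≤-trans (p≤p+q lo (·-nonNeg 14 0≤lo)) (ℚ.≤-trans (p≤p+q (15 · lo) (·-nonNeg e 0≤d)) ≤0)) 0≤lo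

    d-vanishes : 15 · lo ℚ.+ 1 · d ℚ.≤ 0ℚ → d ≡ 0ℚ
    d-vanishes ≤0 = ℚ.≤-antisym (ℚ.≤-trans (p≤p+q d ℚ.≤-refl)
      (ℚ.≤-trans (p≤p+q (1 · d) (·-nonNeg 15 0≤lo)) (ℚ.≤-trans (ℚ.≤-reflexive (ℚ.+-comm (1 · d) (15 · lo))) ≤0))) 0≤d

  gain-reached : ∀ {c k V T} → 0ℚ ℚ.≤ c → T ≡ 21 · 0ℚ ℚ.+ k · c → 5 * k ≤ 9 * V →
    (+ 5 ℚ./ 9) ℚ.* T ℚ.≤ 10 · 0ℚ ℚ.+ V · c
  gain-reached {c} {k} {V} {T} 0≤c T≡ 5k≤9V = ·-cancelˡ-≤ 8 (begin
    9 · ((+ 5 ℚ./ 9) ℚ.* T)         ≡⟨ nine-gains T ⟩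
    5 · T                           ≡⟨ cong (5 ·_) T≡ ⟩
    5 · (21 · 0ℚ ℚ.+ k · c)         ≡⟨ ·-combination 5 21 k 0ℚ c ⟩
    105 · 0ℚ ℚ.+ (5 * k) · c        ≡⟨ cong (ℚ._+ (5 * k) · c) (trans (·-zeroʳ 105) (sym (·-zeroʳ 90))) ⟩
    90 · 0ℚ ℚ.+ (5 * k) · c         ≤⟨ ℚ.+-monoʳ-≤ (90 · 0ℚ) (·-monoˡ-≤ 0≤c 5k≤9V) ⟩
    90 · 0ℚ ℚ.+ (9 * V) · c         ≡⟨ ·-combination 9 10 V 0ℚ c ⟨
    9 · (10 · 0ℚ ℚ.+ V · c)         ∎)
    where open ℚ.≤-Reasoning

  total-score : ∀ {n} (p : Fin n → ℚ) {lo d} (f : ℕ → ℕ) u → (∀ i → p i ≡ lo ℚ.+ f (u + toℕ i) · d) →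
    total p ≡ n · lo ℚ.+ seg f u n · d
  total-score {zero}  p f u p≡ = refl
  total-score {suc n} p {lo} {d} f u p≡ = begin
    p Fin.zero ℚ.+ total (p ∘ Fin.suc)
      ≡⟨ cong₂ ℚ._+_ (trans (p≡ Fin.zero) (cong (λ v → lo ℚ.+ f v · d) (+-identityʳ u)))
           (total-score (p ∘ Fin.suc) f (suc u) λ i → trans (p≡ (Fin.suc i)) (cong (λ v → lo ℚ.+ f v · d) (+-suc u (toℕ i)))) ⟩
    (lo ℚ.+ f u · d) ℚ.+ (n · lo ℚ.+ seg f (suc u) n · d)
      ≡⟨ interchange lo (f u · d) (n · lo) (seg f (suc u) n · d) ⟩
    suc n · lo ℚ.+ (f u · d ℚ.+ seg f (suc u) n · d)
      ≡⟨ cong (suc n · lo ℚ.+_) (×-homo-+ d (f u) (seg f (suc u) n)) ⟨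
    suc n · lo ℚ.+ seg f u (suc n) · d ∎
    where open ≡-Reasoning

  -- Cuttings with at most two sizes.

  record TwoSizes (p : Fin 21 → ℚ) : Set where
    field
      lo d : ℚ
      0≤lo : 0ℚ ℚ.≤ lo
      0≤d  : 0ℚ ℚ.≤ d
      bit  : Fin 21 → ℕ
      bit≤1 : ∀ i → bit i ≤ 1
      size  : ∀ i → p i ≡ lo ℚ.+ bit i · d

  module _ {p : Fin 21 → ℚ} (nonNeg : ∀ i → 0ℚ ℚ.≤ p i) where

    constant : ∀ a → (∀ i → p i ≡ a) → TwoSizes p
    constant a p≡ = record
      { lo = a ; d = 0ℚ ; 0≤lo = subst (0ℚ ℚ.≤_) (p≡ Fin.zero) (nonNeg Fin.zero) ; 0≤d = ℚ.≤-refl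
      ; bit = λ _ → 0 ; bit≤1 = λ _ → z≤n ; size = λ i → trans (p≡ i) (sym (ℚ.+-identityʳ a)) }

    ordered : ∀ a b → a ℚ.≤ b → (∀ i → p i ≡ a ⊎ p i ≡ b) → TwoSizes p
    ordered a b a≤b p∈ with 0ℚ ℚ.≤? a
    -- A negative `a` is the size of no slice, so all slices have size `b`.
    ... | no  0≰a = constant b λ i → [ (λ p≡a → contradiction (subst (0ℚ ℚ.≤_) p≡a (nonNeg i)) 0≰a) , (λ p≡b → p≡b) ]′ (p∈ i)
    ... | yes 0≤a = record
      { lo = a ; d = b ℚ.- a ; 0≤lo = 0≤a
      ; 0≤d = subst (ℚ._≤ b ℚ.- a) (ℚ.+-inverseʳ a) (ℚ.+-monoˡ-≤ (ℚ.- a) a≤b)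
      ; bit = λ i → bits (p∈ i) ; bit≤1 = λ i → bits≤1 (p∈ i) ; size = λ i → bits-size (p∈ i) }
      where
      bits : ∀ {i} → p i ≡ a ⊎ p i ≡ b → ℕ
      bits (inj₁ _) = 0
      bits (inj₂ _) = 1
      bits≤1 : ∀ {i} (c : p i ≡ a ⊎ p i ≡ b) → bits {i} c ≤ 1
      bits≤1 (inj₁ _) = z≤n
      bits≤1 (inj₂ _) = s≤s z≤n
      bits-size : ∀ {i} (c : p i ≡ a ⊎ p i ≡ b) → p i ≡ a ℚ.+ bits {i} c · (b ℚ.- a)
      bits-size (inj₁ p≡a) = trans p≡a (sym (ℚ.+-identityʳ a))
      bits-size (inj₂ p≡b) = trans p≡b (begin
        b                             ≡⟨ ℚ.+-identityʳ b ⟨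
        b ℚ.+ 0ℚ                      ≡⟨ cong (b ℚ.+_) (ℚ.+-inverseˡ a) ⟨
        b ℚ.+ (ℚ.- a ℚ.+ a)           ≡⟨ ℚ.+-assoc b (ℚ.- a) a ⟨
        (b ℚ.- a) ℚ.+ a               ≡⟨ ℚ.+-comm (b ℚ.- a) a ⟩
        a ℚ.+ (b ℚ.- a)               ≡⟨ cong (a ℚ.+_) (ℚ.+-identityʳ (b ℚ.- a)) ⟨
        a ℚ.+ 1 · (b ℚ.- a)           ∎)
        where open ≡-Reasoning

    two-sizes : (∃₂ λ a b → ∀ i → p i ≡ a ⊎ p i ≡ b) → TwoSizes p
    two-sizes (a , b , p∈) with ℚ.≤-total a b
    ... | inj₁ a≤b = ordered a b a≤b p∈
    ... | inj₂ b≤a = ordered b a b≤a λ i → [ inj₂ , inj₁ ]′ (p∈ i)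

  -- The special cutting and its recognition.

  specialBits : Vec ℕ 21
  specialBits = 0 ∷ 0 ∷ 1 ∷ 0 ∷ 1 ∷ 0 ∷ 0 ∷ 1 ∷ 0 ∷ 1 ∷ 0 ∷ 1 ∷ 0 ∷ 0 ∷ 1 ∷ 0 ∷ 1 ∷ 0 ∷ 1 ∷ 0 ∷ 1 ∷ []

  specialBit : Fin 21 → ℕ
  specialBit = lookup specialBits

  special≡ : ∀ j → special j ≡ specialBit j · 1ℚ
  special≡ = toWitness {a? = Fin.all? λ j → special j ℚ.≟ specialBit j · 1ℚ} _

  scaled-special : ∀ c j → c ℚ.* special j ≡ 0ℚ ℚ.+ specialBit j · c
  scaled-special c j = begin
    c ℚ.* special j                 ≡⟨ ℚ.*-comm c (special j) ⟩
    special j ℚ.* c                 ≡⟨ cong (ℚ._* c) (special≡ j) ⟩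
    (specialBit j · 1ℚ) ℚ.* c       ≡⟨ ·-as-* (specialBit j) c ⟨
    specialBit j · c                ≡⟨ ℚ.+-identityˡ (specialBit j · c) ⟨
    0ℚ ℚ.+ specialBit j · c         ∎
    where open ≡-Reasoning

  -- Recovers x from the word m ↦ x (u + 2 m), again because 2 · 11 ≡ 1 (mod 21).
  unroll : List ℕ → Fin 21 → Fin 21 → ℕ
  unroll l u i = nth l ((11 * (toℕ i + (21 ∸ toℕ u))) % 21)

  Recognised : (Fin 21 → ℕ) → Set
  Recognised f = ∃ λ r → (∀ i → f i ≡ specialBit (rot r i)) ⊎ (∀ i → f i ≡ specialBit (refl′ r i))

  recognised? : ∀ f → Dec (Recognised f)
  recognised? f = Fin.any? λ r →
    Fin.all? (λ i → f i ℕ.≟ specialBit (rot r i)) ⊎-dec Fin.all? (λ i → f i ℕ.≟ specialBit (refl′ r i))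

  -- The slice at which the minimal rotation begins depends on the cutting, so all 21 offsets are
  -- checked.
  exceptions-recognised : All (λ l → sum l ≡ 0 ⊎ (∀ u → Recognised (unroll l u))) exceptions
  exceptions-recognised = toWitness
    {a? = All.all? (λ l → (sum l ℕ.≟ 0) ⊎-dec Fin.all? (λ u → recognised? (unroll l u))) exceptions} _

  recognise : ∀ {l es} → All (λ l → sum l ≡ 0 ⊎ (∀ u → Recognised (unroll l u))) es → Any (l ≡_) es →
              sum l ≡ 0 ⊎ (∀ u → Recognised (unroll l u))
  recognise (r All.∷ rs) (here refl) = r
  recognise (r All.∷ rs) (there l∈)  = recognise rs l∈

  unroll-rotated : ∀ {x} → Periodic x → ∀ t i → unroll (tab (rotated x t) 0 21) (slice (t * 2)) i ≡ x (toℕ i)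
  unroll-rotated {x} per t i = begin
    nth (tab y 0 21) ((11 * j) % 21)    ≡⟨ nth-tab y 0 {21} (m%n<n (11 * j) 21) ⟩
    y ((11 * j) % 21 + 0)               ≡⟨ cong y (+-identityʳ ((11 * j) % 21)) ⟩
    y ((11 * j) % 21)                   ≡⟨ periodic-% {y} (rotated-periodic per t) (11 * j) ⟩
    y (11 * j)                          ≡⟨ rotated-11 per t j ⟩
    x (t * 2 + j)                       ≡⟨ cong x (+-comm (t * 2) j) ⟩
    x (j + t * 2)                       ≡⟨ periodic-% {λ v → x (j + v)} (rotation-periodic {x} per j) (t * 2) ⟨
    x (j + (t * 2) % 21)                ≡⟨ cong (λ v → x (j + v)) (toℕ-slice (t * 2)) ⟨
    x (j + toℕ (slice (t * 2)))         ≡⟨ cong x back ⟩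
    x (21 + toℕ i)                      ≡⟨ per (toℕ i) ⟩
    x (toℕ i)                           ∎
    where
    open ≡-Reasoning
    y : ℕ → ℕ
    y = rotated x t
    -- The distance from slice `t * 2` forward to `i`, up to a full turn.
    j : ℕ
    j = toℕ i + (21 ∸ toℕ (slice (t * 2)))
    back : j + toℕ (slice (t * 2)) ≡ 21 + toℕ i
    back = trans (+-assoc (toℕ i) (21 ∸ toℕ (slice (t * 2))) (toℕ (slice (t * 2))))
      (trans (cong (λ v → toℕ i + v) (m∸n+n≡m (<⇒≤ (Fin.toℕ<n (slice (t * 2)))))) (+-comm (toℕ i) 21))

  slice-periodic : ∀ (f : Fin 21 → ℕ) → Periodic (f ∘ slice)
  slice-periodic f s = cong f (slice-cong (21 + s) s (trans (cong (_% 21) (+-comm 21 s)) ([m+n]%n≡m%n s 21)))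

  best-periodic : ∀ {x} → Periodic x → ∀ j → Periodic (best x j)
  best-periodic {x} per j s = trans (sym (best-shift x 21 j s)) (best-cong per j s)

  score-mono : ∀ p g lo d x p≡ → 0ℚ ℚ.≤ d → ∀ {B C} → B ≤ C →
               Play.Wins p g lo d x p≡ B → Play.Wins p g lo d x p≡ C
  score-mono p g lo d x p≡ 0≤d B≤C g≤ = ℚ.≤-trans g≤ (ℚ.+-monoʳ-≤ (10 · lo) (·-monoˡ-≤ 0≤d B≤C))

  Similar : (Fin 21 → ℚ) → Set
  Similar p = ∃ λ c → 0ℚ ℚ.< c × ∃ λ r →
    ((∀ i → p i ≡ c ℚ.* special (rot r i)) ⊎ (∀ i → p i ≡ c ℚ.* special (refl′ r i)))

  -- Necessity.

  module Necessity (p : Fin 21 → ℚ) (total>0 : 0ℚ ℚ.< total p) (sizes : TwoSizes p)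
                   (gain : BobHasGain p ((+ 5 ℚ./ 9) ℚ.* total p)) where
    open TwoSizes sizes

    x : ℕ → ℕ
    x = bit ∘ slice

    k : ℕ
    k = seg x 0 21

    per : Periodic x
    per = slice-periodic bit

    total≡ : total p ≡ 21 · lo ℚ.+ k · d
    total≡ = total-score p {lo} {d} x 0 λ i → trans (size i) (cong (λ j → lo ℚ.+ bit j · d) (sym (slice-toℕ i)))

    wins : ∀ s → (+ 5 ℚ./ 9) ℚ.* total p ℚ.≤ 10 · lo ℚ.+ best x 10 s · d
    wins s = subst (λ v → (+ 5 ℚ./ 9) ℚ.* total p ℚ.≤ 10 · lo ℚ.+ v · d) (best-periodic per 10 s)
      -- A first move at `20 + s` leaves the arc starting at `21 + s`, which is the arc at `s` by
      -- periodicity.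
      (Play.gain-necessary p _ lo d x (size ∘ slice) (score-mono p _ lo d x (size ∘ slice) 0≤d) gain (20 + s))

    worthless : lo ≡ 0ℚ → k · d ≡ 0ℚ → ∀ {A : Set} → A
    worthless lo≡0 kd≡0 = contradiction total>0 (ℚ.<-irrefl (sym (begin
      total p                  ≡⟨ total≡ ⟩
      21 · lo ℚ.+ k · d        ≡⟨ cong₂ (λ v w → 21 · v ℚ.+ w) lo≡0 kd≡0 ⟩
      21 · 0ℚ ℚ.+ 0ℚ           ≡⟨ ℚ.+-identityʳ (21 · 0ℚ) ⟩
      21 · 0ℚ                  ≡⟨ ·-zeroʳ 21 ⟩
      0ℚ                       ∎)))
      where open ≡-Reasoning

    conclude : Classified x → Similar p
    -- A strict deficit makes both `lo` and `d` vanish, against the positive total.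
    conclude (inj₁ (s , light)) = worthless (lo-vanishes 0≤lo 0≤d {1} deficit)
        (trans (cong (k ·_) (d-vanishes 0≤lo 0≤d deficit)) (·-zeroʳ k))
      where
      deficit : 15 · lo ℚ.+ 1 · d ℚ.≤ 0ℚ
      deficit = gain-deficit 0≤lo 0≤d {k} {best x 10 s} {1} total≡
        (≤-trans (≤-reflexive (+-comm (9 * best x 10 s) 1)) (light-< light)) (wins s)
    conclude (inj₂ ((s , fair) , t , l∈)) = [ (λ none → worthless lo≡0 (cong (_· d) (trans (sym count) none)))
                                           , (λ r → similar (r (slice (t * 2)))) ]′ (recognise exceptions-recognised l∈)
      where
      count : seg (rotated x t) 0 21 ≡ k
      count = seg-rotated per t
      lo≡0 : lo ≡ 0ℚ
      lo≡0 = lo-vanishes 0≤lo 0≤d {0} (gain-deficit 0≤lo 0≤d {k} {best x 10 s} {0} total≡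
        (≤-trans (≤-reflexive (+-identityʳ (9 * best x 10 s))) fair) (wins s))
      d>0 : 0ℚ ℚ.< d
      d>0 = ℚ.≰⇒> λ d≤0 → worthless lo≡0 (trans (cong (k ·_) (ℚ.≤-antisym d≤0 0≤d)) (·-zeroʳ k))
      scaled : ∀ i j → unroll (tab (rotated x t) 0 21) (slice (t * 2)) i ≡ specialBit j → p i ≡ d ℚ.* special j
      scaled i j eq = trans (size i) (trans (cong₂ (λ v b → v ℚ.+ b · d) lo≡0
        (trans (cong bit (sym (slice-toℕ i))) (trans (sym (unroll-rotated per t i)) eq))) (sym (scaled-special d j)))
      similar : Recognised (unroll (tab (rotated x t) 0 21) (slice (t * 2))) → Similar p
      similar (r , inj₁ f) = d , d>0 , r , inj₁ λ i → scaled i (rot r i) (f i)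
      similar (r , inj₂ f) = d , d>0 , r , inj₂ λ i → scaled i (refl′ r i) (f i)

  -- Sufficiency.

  AllHeavy : ℕ → ℕ → (Fin 21 → ℕ) → Set
  AllHeavy j n f = All (λ v → 5 * seg (f ∘ slice) 0 21 ≤ 9 * v) (values j n (tab (f ∘ slice) 0 (suc (j * 2 + n))))

  allHeavy? : ∀ j n (F : Fin 21 → Fin 21 → ℕ) → Dec (∀ r → AllHeavy j n (F r))
  allHeavy? j n F = Fin.all? λ r →
    All.all? (λ v → (5 * seg (F r ∘ slice) 0 21) ℕ.≤? (9 * v)) (values j n (tab (F r ∘ slice) 0 (suc (j * 2 + n))))

  from-does : ∀ {A : Set} (a? : Dec A) → does a? ≡ true → A
  from-does (yes a) _ = a

  All-tab : ∀ (P : ℕ → Set) f u n → All P (tab f u n) → ∀ {i} → i < n → P (f (i + u))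
  All-tab P f u (suc n) (px All.∷ pxs) {zero}  _         = px
  All-tab P f u (suc n) (px All.∷ pxs) {suc i} (s≤s i<n) =
    subst (P ∘ f) (+-suc i u) (All-tab P f (suc u) n pxs i<n)

  heavy-tab : ∀ j n F → does (allHeavy? j n F) ≡ true →
    ∀ r {s} → s < n → 5 * seg (F r ∘ slice) 0 21 ≤ 9 * best (F r ∘ slice) j s
  heavy-tab j n F heavy r {s} s<n = subst (λ v → 5 * seg x 0 21 ≤ 9 * best x j v) (+-identityʳ s)
    (All-tab (λ v → 5 * seg x 0 21 ≤ 9 * v) (best x j) 0 n
      (subst (All (λ v → 5 * seg x 0 21 ≤ 9 * v)) (values-tab x j n refl) (from-does (allHeavy? j n F) heavy r)) s<n)
    where
    x : ℕ → ℕ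
    x = F r ∘ slice

  -- By periodicity the 21 arcs that are evaluated represent all starting points.
  heavy-values : ∀ F → does (allHeavy? 10 21 F) ≡ true →
    ∀ r s → 5 * seg (F r ∘ slice) 0 21 ≤ 9 * best (F r ∘ slice) 10 s
  heavy-values F heavy r s = subst (λ v → 5 * seg (F r ∘ slice) 0 21 ≤ 9 * v)
    (periodic-% {best (F r ∘ slice) 10} (best-periodic (slice-periodic (F r)) 10) s) (heavy-tab 10 21 F heavy r (m%n<n s 21))

  rotBits reflBits : Fin 21 → Fin 21 → ℕ
  rotBits  r i = specialBit (rot r i)
  reflBits r i = specialBit (refl′ r i)

  rot-heavy : does (allHeavy? 10 21 rotBits) ≡ true
  rot-heavy = refl

  refl′-heavy : does (allHeavy? 10 21 reflBits) ≡ true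
  refl′-heavy = refl

  sufficiency : ∀ (p : Fin 21 → ℚ) c → 0ℚ ℚ.< c → ∀ (ρ : Fin 21 → Fin 21) →
    (∀ s → 5 * seg (specialBit ∘ ρ ∘ slice) 0 21 ≤ 9 * best (specialBit ∘ ρ ∘ slice) 10 s) →
    (∀ i → p i ≡ c ℚ.* special (ρ i)) → BobHasGain p ((+ 5 ℚ./ 9) ℚ.* total p)
  sufficiency p c 0<c ρ heavy p≡ = Play.gain-sufficient p _ 0ℚ c x sizes (score-mono p _ 0ℚ c x sizes (ℚ.<⇒≤ 0<c))
    λ s → gain-reached {c} {seg x 0 21} {best x 10 s} (ℚ.<⇒≤ 0<c) (total-score p {0ℚ} {c} x 0 λ i →
      trans (bits i) (cong (λ j → 0ℚ ℚ.+ specialBit (ρ j) · c) (sym (slice-toℕ i)))) (heavy s)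
    where
    x : ℕ → ℕ
    x = specialBit ∘ ρ ∘ slice
    bits : ∀ i → p i ≡ 0ℚ ℚ.+ specialBit (ρ i) · c
    bits i = trans (p≡ i) (scaled-special c (ρ i))
    sizes : ∀ s → p (slice s) ≡ 0ℚ ℚ.+ x s · c
    sizes s = bits (slice s)

  similar-gains : ∀ p → Similar p → BobHasGain p ((+ 5 ℚ./ 9) ℚ.* total p)
  similar-gains p (c , 0<c , r , inj₁ f) = sufficiency p c 0<c (rot r) (heavy-values rotBits rot-heavy r) f
  similar-gains p (c , 0<c , r , inj₂ f) = sufficiency p c 0<c (refl′ r) (heavy-values reflBits refl′-heavy r) f

-- Evaluation of the search, and the theorem.

open Words
open Game
open import Data.Rational using (_≤_; _<_; _*_; _/_)

search₀ : search leaf 20 1 0 (0 ∷ []) ≡ true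
search₀ = refl

-- Only the word of ones is tested: after a leading 1 a letter 0 would give a smaller rotation.
search₁ : search leaf 20 1 0 (1 ∷ []) ≡ true
search₁ = refl

theorem5 : (p : Fin 21 → ℚ) →
    (∀ i → 0ℚ ≤ p i) →
    0ℚ < total p →
    (∃₂ λ a b → ∀ i → p i ≡ a ⊎ p i ≡ b) →
    (BobHasGain p ((+ 5 / 9) * total p) →
       ∃ λ c → 0ℚ < c × ∃ λ r →
         ((∀ i → p i ≡ c * special (rot r i)) ⊎ (∀ i → p i ≡ c * special (refl′ r i))))
    × ((∃ λ c → 0ℚ < c × ∃ λ r →
         ((∀ i → p i ≡ c * special (rot r i)) ⊎ (∀ i → p i ≡ c * special (refl′ r i)))) →
       BobHasGain p ((+ 5 / 9) * total p))
theorem5 p nonNeg total>0 p∈ = necessary , similar-gains p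
  where
  sizes : TwoSizes p
  sizes = two-sizes nonNeg p∈
  open TwoSizes sizes

  classified : Classified (bit ∘ slice)
  classified = Classify.classify leaf leaf-sound search₀ search₁ (bit≤1 ∘ slice) (slice-periodic bit)

  necessary : BobHasGain p ((+ 5 / 9) * total p) → Similar p
  necessary gain = Necessity.conclude p total>0 sizes gain classified
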